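{- Let $k,n\in\mathbb{N}$ with $n\ge2$. For every $m\in\mathbb{N}_0$ and every $\vec\xi=(\xi_0,\ldots,\xi_{k-1})\in\mathbb{C}^k$ one has $$\mathcal{H}_m(\vec\xi\otimes\vec\zeta_n')=\sum_{j=0}^{[m/n]}(-1)^{m-jn}\,\mathcal{E}_{m-jn}(\vec\xi\,)\,\mathcal{H}_j(\vec\xi^{\,n}).$$ Further: (1) if $m\le(n-1)k$, then $$\mathcal{E}_m(\vec\xi\otimes\vec\zeta_n')=\sum_{j=0}^{[m/n]}(-1)^{m-j}\,\mathcal{H}_{m-jn}(\vec\xi\,)\,\mathcal{E}_j(\vec\xi^{\,n});$$ (2) if $m>(n-1)k$, then $$\sum_{j=0}^{[M/n]}(-1)^{m-j}\,\mathcal{H}_{m-jn}(\vec\xi\,)\,\mathcal{E}_j(\vec\xi^{\,n})=0,$$ where $M:=\min\{m,nk\}$.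
   Context: $\mathbb{N}=\{1,2,\ldots\}$, $\mathbb{N}_0=\mathbb{N}\cup\{0\}$; $[t]$ is the integer part of the real number $t$. $\zeta_n:=e^{2\pi i/n}$ and $\vec\zeta_n':=(\zeta_n,\zeta_n^2,\ldots,\zeta_n^{n-1})\in\mathbb{C}^{n-1}$. For $\vec\xi=(\xi_0,\ldots,\xi_{k-1})\in\mathbb{C}^k$, $\vec\xi^{\,n}:=(\xi_0^n,\ldots,\xi_{k-1}^n)$. The Kronecker product of $\vec x=(x_1,\ldots,x_a)\in\mathbb{C}^a$ and $\vec y=(y_1,\ldots,y_b)\in\mathbb{C}^b$ is $\vec x\otimes\vec y=(x_1\vec y,\ldots,x_a\vec y)\in\mathbb{C}^{ab}$, where $x_j\vec y=(x_jy_1,\ldots,x_jy_b)$. For $\vec z=(z_1,\ldots,z_r)\in\mathbb{C}^r$, the elementary symmetric polynomials are $\mathcal{E}_0(\vec z):=1$, $\mathcal{E}_m(\vec z):=\sum_{1\le j_1<\cdots<j_m\le r}z_{j_1}\cdots z_{j_m}$ for $1\le m\le r$, $\mathcal{E}_m(\vec z):=0$ for $m>r$; the complete homogeneous symmetric polynomials are $\mathcal{H}_0(\vec z):=1$ and $\mathcal{H}_m(\vec z):=\sum_{1\le j_1\le\cdots\le j_m\le r}z_{j_1}\cdots z_{j_m}$ for $m\ge1$. -}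

module Defs where

open import Level using (Level; _⊔_) renaming (suc to lsuc)
open import Algebra.Apartness.Bundles using (HeytingField; HeytingCommutativeRing)
open import Algebra.Bundles using (CommutativeRing)
open import Algebra.Bundles.Raw using (RawRing)
import Algebra.Definitions.RawSemiring as RawSemiringDefs
open import Data.Fin.Base as Fin using (Fin; toℕ)
import Data.Fin.Properties as Fin
open import Data.List.Base as List using (List; []; _∷_)
open import Data.Nat.Base as ℕ using (ℕ; zero; suc; NonZero; _!)
open import Data.Nat.Properties using (_!≢0)
open import Data.Product.Base using (∃-syntax; _×_; proj₁)
open import Data.Sum.Base using (_⊎_; inj₁; inj₂)
open import Data.Vec.Base as Vec using (Vec)
open import Data.Vec.Functional as Vector using (Vector)
open import Data.Vec.Relation.Unary.Linked using (linked?)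
open import Function.Bundles using (_⇔_; Equivalence)
open import Relation.Binary.Core using (Rel)
open import Relation.Binary.Structures using (IsStrictPartialOrder)
open import Relation.Nullary.Negation.Core using (¬_)

private
  variable
    c ℓ ℓ₁ ℓ₂ ℓ₃ : Level

-- The standard library has no real numbers.  They are given by their
-- axiomatic characterisation: a Cauchy-complete Archimedean ordered field,
-- which is unique up to isomorphism.  The axioms are phrased with a strict
-- order and an apartness relation, so that they hold both of the classical
-- reals (with _#_ the negation of _≈_) and of the constructive Cauchy reals.

record OrderedField c ℓ₁ ℓ₂ ℓ₃ : Set (lsuc (c ⊔ ℓ₁ ⊔ ℓ₂ ⊔ ℓ₃)) where
  infix 4 _<_
  field
    heytingField : HeytingField c ℓ₁ ℓ₂

  open HeytingField heytingField public

  field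
    _<_                  : Rel Carrier ℓ₃
    isStrictPartialOrder : IsStrictPartialOrder _≈_ _<_
    #⇔<⊎>                : ∀ x y → x # y ⇔ (x < y ⊎ y < x)
    0<1                  : 0# < 1#
    +-monoʳ-<            : ∀ x {y z} → y < z → x + y < x + z
    *-pos                : ∀ {x y} → 0# < x → 0# < y → 0# < x * y

  open IsStrictPartialOrder isStrictPartialOrder public
    using (<-respʳ-≈; <-respˡ-≈) renaming (trans to <-trans; irrefl to <-irrefl)

  commutativeRing : CommutativeRing c ℓ₁
  commutativeRing = HeytingCommutativeRing.commutativeRing heytingCommutativeRing

  open RawSemiringDefs (RawRing.rawSemiring (CommutativeRing.rawRing commutativeRing))
    using () renaming (_×_ to _⋆_)

  fromℕ : ℕ → Carrier
  fromℕ n = n ⋆ 1#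

  0<fromℕ : ∀ n → 0# < fromℕ (suc n)
  0<fromℕ zero    = <-respʳ-≈ (sym (+-identityʳ 1#)) 0<1
  0<fromℕ (suc n) =
    <-trans 0<1 (<-respˡ-≈ (+-identityʳ 1#) (+-monoʳ-< 1# (0<fromℕ n)))

  fromℕ#0 : ∀ n → fromℕ (suc n) # 0#
  fromℕ#0 n = Equivalence.from (#⇔<⊎> _ _) (inj₂ (0<fromℕ n))

  -- 1 / n, as the inverse of n - 0
  recip : (n : ℕ) → .{{_ : NonZero n}} → Carrier
  recip (suc n) = proj₁ (#⇒invertible (fromℕ#0 n))

  -- |x - y| < ε
  Within : Carrier → Carrier → Carrier → Set ℓ₃
  Within ε x y = (x < y + ε) × (y < x + ε)

  Cauchy : (ℕ → Carrier) → Set (c ⊔ ℓ₃)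
  Cauchy a = ∀ ε → 0# < ε →
    ∃[ N ] (∀ p q → N ℕ.≤ p → N ℕ.≤ q → Within ε (a p) (a q))

  ConvergesTo : (ℕ → Carrier) → Carrier → Set (c ⊔ ℓ₃)
  ConvergesTo a x = ∀ ε → 0# < ε →
    ∃[ N ] (∀ p → N ℕ.≤ p → Within ε (a p) x)

record RealNumbers c ℓ₁ ℓ₂ ℓ₃ : Set (lsuc (c ⊔ ℓ₁ ⊔ ℓ₂ ⊔ ℓ₃)) where
  field
    orderedField : OrderedField c ℓ₁ ℓ₂ ℓ₃

  open OrderedField orderedField public

  field
    archimedean : ∀ x → ∃[ n ] x < fromℕ n
    complete    : ∀ a → Cauchy a → ∃[ x ] ConvergesTo a x

module SymmetricPolynomials (R : RawRing c ℓ) where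
  open RawRing R
  open RawSemiringDefs rawSemiring public using (_^_; sum)

  -- f 0 + f 1 + ⋯ + f t
  ∑[0⋯_]_ : ℕ → (ℕ → Carrier) → Carrier
  ∑[0⋯ t ] f = sum {suc t} (λ j → f (toℕ j))

  _⊗_ : ∀ {a b} → Vector Carrier a → Vector Carrier b → Vector Carrier (a ℕ.* b)
  x ⊗ y = Vector.concat (Vector.map (λ xⱼ → Vector.map (xⱼ *_) y) x)

  _^ᵛ_ : ∀ {r} → Vector Carrier r → ℕ → Vector Carrier r
  z ^ᵛ n = Vector.map (_^ n) z

  tuples : ∀ m r → List (Vec (Fin r) m)
  tuples zero    r = Vec.[] ∷ []
  tuples (suc m) r = List.cartesianProductWith Vec._∷_ (List.allFin r) (tuples m r)

  -- z_{j₁} ⋯ z_{jₘ}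
  monomial : ∀ {r m} → Vector Carrier r → Vec (Fin r) m → Carrier
  monomial z js = Vec.foldr′ _*_ 1# (Vec.map z js)

  sumOver : ∀ {r m} → Vector Carrier r → List (Vec (Fin r) m) → Carrier
  sumOver z jss = List.foldr _+_ 0# (List.map (monomial z) jss)

  -- Sum over j₁ < ⋯ < jₘ.  For m = 0 the only index is the empty tuple,
  -- with monomial 1; for m > r there is no index and the sum is 0.
  ℰ : ∀ {r} → ℕ → Vector Carrier r → Carrier
  ℰ {r} m z = sumOver z (List.filter (linked? Fin._<?_) (tuples m r))

  -- Sum over j₁ ≤ ⋯ ≤ jₘ.
  ℋ : ∀ {r} → ℕ → Vector Carrier r → Carrier
  ℋ {r} m z = sumOver z (List.filter (linked? Fin._≤?_) (tuples m r))

module ComplexNumbers (ℝ : RealNumbers c ℓ₁ ℓ₂ ℓ₃) where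
  private
    module ℝ = RealNumbers ℝ

  infix 5 _+i_
  record ℂ : Set c where
    constructor _+i_
    field
      re im : ℝ.Carrier
  open ℂ public

  ℂ-rawRing : RawRing c ℓ₁
  ℂ-rawRing = record
    { Carrier = ℂ
    ; _≈_     = λ z w → (re z ℝ.≈ re w) × (im z ℝ.≈ im w)
    ; _+_     = λ z w → (re z ℝ.+ re w) +i (im z ℝ.+ im w)
    ; _*_     = λ z w → (re z ℝ.* re w ℝ.- im z ℝ.* im w) +i (re z ℝ.* im w ℝ.+ im z ℝ.* re w)
    ; -_      = λ z → (ℝ.- re z) +i (ℝ.- im z)
    ; 0#      = ℝ.0# +i ℝ.0#
    ; 1#      = ℝ.1# +i ℝ.0#
    }

  open RawRing ℂ-rawRing public
    using (_≈_; _+_; _*_; -_; 0#; 1#)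
  open SymmetricPolynomials ℂ-rawRing public

  ofReal : ℝ.Carrier → ℂ
  ofReal x = x +i ℝ.0#

  -- z⁰/0! + ⋯ + zᴺ/N!
  expSum : ℂ → ℕ → ℂ
  expSum z N = ∑[0⋯ N ] λ j → ofReal (ℝ.recip (j !) {{j !≢0}}) * z ^ j

  -- w = eᶻ
  IsExp : ℂ → ℂ → Set (c ⊔ ℓ₃)
  IsExp z w = ℝ.ConvergesTo (λ N → re (expSum z N)) (re w)
            × ℝ.ConvergesTo (λ N → im (expSum z N)) (im w)

  -- s = sin x, that is, s is the imaginary part of e^{ix}
  IsSin : ℝ.Carrier → ℝ.Carrier → Set (c ⊔ ℓ₃)
  IsSin x s = ∃[ t ] IsExp (ℝ.0# +i x) (t +i s)

  -- π is the least positive zero of the sine.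
  IsPi : ℝ.Carrier → Set (c ⊔ ℓ₃)
  IsPi π = ℝ.0# ℝ.< π
         × IsSin π ℝ.0#
         × (∀ x → ℝ.0# ℝ.< x → x ℝ.< π → ¬ IsSin x ℝ.0#)

  -- ζ = e^{2πi/n}
  Isζ : (n : ℕ) → .{{_ : NonZero n}} → ℂ → Set (c ⊔ ℓ₃)
  Isζ n ζ = ∃[ π ] IsPi π × IsExp (ℝ.0# +i (ℝ.fromℕ 2 ℝ.* π ℝ.* ℝ.recip n)) ζ

  -- (ζ, ζ², …, ζⁿ⁻¹)
  powers : (n : ℕ) → ℂ → Vector ℂ (n ℕ.∸ 1)
  powers n ζ i = ζ ^ suc (toℕ i)

{-# OPTIONS --safe #-}
module Submission where

-- The power series ∏ᵢ (1 - zᵢt) and ∏ᵢ (1 - zᵢt)⁻¹ have the coefficients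
-- (-1)ᵐ ℰₘ(z) and ℋₘ(z).  Since ∏_{0≤j<n} (1 - ξζʲt) = 1 - ξⁿtⁿ, the vector
-- z = ξ ⊗ ζ⃗′ has ∏ (1 - zᵢt) = ∏ᵢ (1 - ξᵢⁿtⁿ) / (1 - ξᵢt).  Reading off the
-- coefficients of this series and of its inverse gives the two formulas; the
-- series is a polynomial of degree at most (n - 1)k, which gives the vanishing.
--
-- The factorisation of 1 - tⁿ: p(t) = ∏_{0≤j<n} (1 - ζʲt) satisfies
-- p(ζt) = p(t), so that (1 - ζʳ) pᵣ = 0, and pᵣ = 0 for 0 < r < n because
-- 1 - ζʳ is not a zero divisor.  As 1 - t divides p, this forces pₙ = -1.
--
-- That ζ = e^{2πi/n} is a primitive n-th root of unity follows from
-- e^{z+w} = e^z e^w and e^z̄ = conj e^z, proved with the Cauchy product: sin π = 0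
-- gives e^{2πi} = 1, and ζʳ = 1 with 0 < r < n would make πr/n ∈ (0, π) a
-- zero of the sine.

open import Defs
open import Algebra.Bundles using (CommutativeRing)
import Algebra.Apartness.Properties.HeytingCommutativeRing as HeytingProperties
import Algebra.Properties.AbelianGroup as AbelianGroupProperties
import Algebra.Properties.CommutativeSemiring.Binomial as Binomial
import Algebra.Properties.Ring as RingProperties
import Algebra.Properties.Semiring.Exp as SemiringExp
import Algebra.Properties.Semiring.Mult as SemiringMult
import Algebra.Properties.Semiring.Mult.TCOptimised as TCOptimisedMult
import Algebra.Properties.Semiring.Sum as SemiringSum
import Algebra.Solver.Ring as RingSolver
open import Algebra.Solver.Ring.AlmostCommutativeRing
  using (fromCommutativeRing; _-Raw-AlmostCommutative⟶_)
open import Data.Bool.Base using (true; false; if_then_else_; _∧_)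
open import Data.Empty using (⊥; ⊥-elim)
open import Data.Fin.Base as Fin using (Fin; toℕ)
import Data.Fin.Properties as Fin
open import Data.Integer.Base as ℤ using (ℤ; +_; -[1+_]; _⊖_)
import Data.Integer.Properties as ℤ
open import Data.List.Base as List using (List; []; _∷_)
open import Data.Maybe.Base as Maybe using (Maybe)
open import Data.Nat.Base as ℕ using (ℕ; zero; suc; _!)
import Data.Nat.DivMod as ℕ
import Data.Nat.Properties as ℕ
open import Data.Product.Base using (_×_; _,_; proj₁; proj₂; ∃-syntax)
open import Data.Sum.Base using (_⊎_; inj₁; inj₂; [_,_]′)
open import Data.Vec.Base as Vec using (Vec)
open import Data.Vec.Functional as Vector using (Vector; head; tail)
open import Data.Vec.Relation.Unary.Linked using (linked?)
open import Function.Base using (_∘_; id)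
open import Function.Bundles using (Equivalence)
open import Level using (_⊔_)
open import Relation.Binary.Consequences using (dec⇒weaklyDec)
open import Relation.Binary.Core using (Rel)
open import Relation.Binary.Definitions using (Decidable; tri<; tri≈; tri>)
open import Relation.Binary.PropositionalEquality as ≡ using (_≡_)
import Relation.Binary.Reasoning.Setoid as SetoidReasoning
open import Relation.Nullary.Decidable.Core using (does)
open import Relation.Nullary.Negation.Core using (¬_)
import Relation.Unary as Unary

-- No ring of power series is built. A product of factors 1 - atⁿ is a composition of operators on
-- coefficient sequences, and an identity that involves inverse series is proved after applying such
-- an operator to both sides; it is injective because the exponent n is positive. The axioms for the
-- reals are constructive: order and equality are not decidable, and the minimality of π is a
-- negative statement. So ζʳ ≠ 1 comes without apartness, and 1 - ζʳ cannot simply be inverted. This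
-- is why the algebraic part asks for an implication between equalities, ζʳa = a ⇒ a = 0: tightness
-- of the apartness lets an equality be proved by contradiction. The analytic part follows the same
-- constraint. Two-sided bounds replace absolute values, and the majorants are natural numbers times
-- powers of ½, so that the Archimedean axiom turns them into null sequences.

-- Ring solver with integer coefficients over any commutative ring.

module IntegerSolver {c ℓ} (R : CommutativeRing c ℓ) where
  open CommutativeRing R
  open AbelianGroupProperties +-abelianGroup using (⁻¹-∙-comm; ⁻¹-involutive; ε⁻¹≈ε)
  open RingProperties ring using (-‿distribˡ-*; -‿distribʳ-*)
  open TCOptimisedMult semiring using (1+×; ×-homo-+; ×1-homo-*) renaming (_×_ to _⋆_)
  open SetoidReasoning setoid

  -- Equality in R is not decidable, so the solver takes its coefficients in ℤ. With the optimised
  -- multiple, `1 ⋆ 1#` computes to `1#`, so that `con (+ 1)` denotes `1#` itself.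
  ⟦_⟧ℤ : ℤ → Carrier
  ⟦ + n      ⟧ℤ = n ⋆ 1#
  ⟦ -[1+ n ] ⟧ℤ = - (suc n ⋆ 1#)

  ⟦⟧-neg : ∀ i → ⟦ ℤ.- i ⟧ℤ ≈ - ⟦ i ⟧ℤ
  ⟦⟧-neg (+ zero)  = sym ε⁻¹≈ε
  ⟦⟧-neg (+ suc n) = refl
  ⟦⟧-neg -[1+ n ]  = sym (⁻¹-involutive _)

  ⟦⟧-⊖ : ∀ m n → ⟦ m ⊖ n ⟧ℤ ≈ m ⋆ 1# - n ⋆ 1#
  ⟦⟧-⊖ m       zero    = sym (trans (+-congˡ ε⁻¹≈ε) (+-identityʳ _))
  ⟦⟧-⊖ zero    (suc n) = sym (+-identityˡ _)
  ⟦⟧-⊖ (suc m) (suc n) = begin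
    ⟦ suc m ⊖ suc n ⟧ℤ                     ≡⟨ ≡.cong ⟦_⟧ℤ (ℤ.[1+m]⊖[1+n]≡m⊖n m n) ⟩
    ⟦ m ⊖ n ⟧ℤ                             ≈⟨ ⟦⟧-⊖ m n ⟩
    m ⋆ 1# - n ⋆ 1#                        ≈⟨ +-identityˡ _ ⟨
    0# + (m ⋆ 1# - n ⋆ 1#)                 ≈⟨ +-congʳ (-‿inverseʳ 1#) ⟨
    (1# - 1#) + (m ⋆ 1# - n ⋆ 1#)          ≈⟨ +-assoc 1# _ _ ⟩
    1# + (- 1# + (m ⋆ 1# - n ⋆ 1#))        ≈⟨ +-congˡ (+-comm _ _) ⟩
    1# + ((m ⋆ 1# - n ⋆ 1#) + - 1#)        ≈⟨ +-congˡ (+-assoc _ _ _) ⟩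
    1# + (m ⋆ 1# + (- (n ⋆ 1#) + - 1#))    ≈⟨ +-congˡ (+-congˡ (+-comm _ _)) ⟩
    1# + (m ⋆ 1# + (- 1# + - (n ⋆ 1#)))    ≈⟨ +-congˡ (+-congˡ (⁻¹-∙-comm _ _)) ⟩
    1# + (m ⋆ 1# - (1# + n ⋆ 1#))          ≈⟨ +-assoc 1# _ _ ⟨
    (1# + m ⋆ 1#) - (1# + n ⋆ 1#)          ≈⟨ +-cong (1+× m 1#) (-‿cong (1+× n 1#)) ⟨
    suc m ⋆ 1# - suc n ⋆ 1#                ∎

  ⟦⟧-+ : ∀ i j → ⟦ i ℤ.+ j ⟧ℤ ≈ ⟦ i ⟧ℤ + ⟦ j ⟧ℤ
  ⟦⟧-+ (+ m)    (+ n)    = ×-homo-+ 1# m n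
  ⟦⟧-+ (+ m)    -[1+ n ] = ⟦⟧-⊖ m (suc n)
  ⟦⟧-+ -[1+ m ] (+ n)    = trans (⟦⟧-⊖ n (suc m)) (+-comm _ _)
  ⟦⟧-+ -[1+ m ] -[1+ n ] = begin
    - (suc (suc (m ℕ.+ n)) ⋆ 1#)         ≡⟨ ≡.cong (λ k → - (k ⋆ 1#)) (≡.cong suc (ℕ.+-suc m n)) ⟨
    - ((suc m ℕ.+ suc n) ⋆ 1#)           ≈⟨ -‿cong (×-homo-+ 1# (suc m) (suc n)) ⟩
    - (suc m ⋆ 1# + suc n ⋆ 1#)          ≈⟨ ⁻¹-∙-comm _ _ ⟨
    - (suc m ⋆ 1#) - suc n ⋆ 1#          ∎

  ⟦⟧-pos-* : ∀ m j → ⟦ + m ℤ.* j ⟧ℤ ≈ ⟦ + m ⟧ℤ * ⟦ j ⟧ℤ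
  ⟦⟧-pos-* m (+ n) = begin
    ⟦ + m ℤ.* + n ⟧ℤ      ≡⟨ ≡.cong ⟦_⟧ℤ (ℤ.pos-* m n) ⟨
    (m ℕ.* n) ⋆ 1#        ≈⟨ ×1-homo-* m n ⟩
    m ⋆ 1# * n ⋆ 1#       ∎
  ⟦⟧-pos-* m -[1+ n ] = begin
    ⟦ + m ℤ.* -[1+ n ] ⟧ℤ         ≡⟨ ≡.cong ⟦_⟧ℤ (ℤ.neg-distribʳ-* (+ m) (+ suc n)) ⟨
    ⟦ ℤ.- (+ m ℤ.* + suc n) ⟧ℤ    ≈⟨ ⟦⟧-neg (+ m ℤ.* + suc n) ⟩
    - ⟦ + m ℤ.* + suc n ⟧ℤ        ≈⟨ -‿cong (⟦⟧-pos-* m (+ suc n)) ⟩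
    - (m ⋆ 1# * suc n ⋆ 1#)       ≈⟨ -‿distribʳ-* _ _ ⟩
    m ⋆ 1# * - (suc n ⋆ 1#)       ∎

  ⟦⟧-* : ∀ i j → ⟦ i ℤ.* j ⟧ℤ ≈ ⟦ i ⟧ℤ * ⟦ j ⟧ℤ
  ⟦⟧-* (+ m)    j = ⟦⟧-pos-* m j
  ⟦⟧-* -[1+ m ] j = begin
    ⟦ -[1+ m ] ℤ.* j ⟧ℤ           ≡⟨ ≡.cong ⟦_⟧ℤ (ℤ.neg-distribˡ-* (+ suc m) j) ⟨
    ⟦ ℤ.- (+ suc m ℤ.* j) ⟧ℤ      ≈⟨ ⟦⟧-neg (+ suc m ℤ.* j) ⟩
    - ⟦ + suc m ℤ.* j ⟧ℤ          ≈⟨ -‿cong (⟦⟧-pos-* (suc m) j) ⟩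
    - (suc m ⋆ 1# * ⟦ j ⟧ℤ)       ≈⟨ -‿distribˡ-* _ _ ⟩
    - (suc m ⋆ 1#) * ⟦ j ⟧ℤ       ∎

  morphism : ℤ.+-*-rawRing -Raw-AlmostCommutative⟶ fromCommutativeRing R
  morphism = record
    { ⟦_⟧ = ⟦_⟧ℤ ; +-homo = ⟦⟧-+ ; *-homo = ⟦⟧-* ; -‿homo = ⟦⟧-neg
    ; 0-homo = refl ; 1-homo = refl }

  ⟦⟧-≟ : ∀ i j → Maybe (⟦ i ⟧ℤ ≈ ⟦ j ⟧ℤ)
  ⟦⟧-≟ i j = Maybe.map (λ i≡j → reflexive (≡.cong ⟦_⟧ℤ i≡j)) (dec⇒weaklyDec ℤ._≟_ i j)

  open RingSolver ℤ.+-*-rawRing (fromCommutativeRing R) morphism ⟦⟧-≟ public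

-- Formal power series: linear factors, dilation, convolution.

-- A formal power series Σ fₘ tᵐ is its coefficient sequence.
module PowerSeries {c ℓ} (R : CommutativeRing c ℓ) where
  open CommutativeRing R hiding (zero)
  open IntegerSolver R using (solve; _:=_; _:+_; _:*_; _:-_; :-_; con)
  open SetoidReasoning setoid
  open SemiringExp semiring using (_^_)

  Series : Set c
  Series = ℕ → Carrier

  infix 4 _≐_
  _≐_ : Series → Series → Set ℓ
  f ≐ g = ∀ m → f m ≈ g m

  𝟙 : Series
  𝟙 zero    = 1#
  𝟙 (suc _) = 0#

  -- The common shape of all factors: (1 - atⁿ)f is f - ag with g = tⁿf. Compatibility of dilation
  -- and convolution with factors reduces to linearity in this shape and to shifts.
  _-[_]_ : Series → Carrier → Series → Series
  (f -[ a ] g) m = f m - a * g m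

  -- tⁿ f
  shift : ℕ → Series → Series
  shift zero    f m       = f m
  shift (suc n) f zero    = 0#
  shift (suc n) f (suc m) = shift n f m

  [1-_t^_] : Carrier → ℕ → Series → Series
  [1- a t^ n ] f = f -[ a ] shift n f

  -- The recursion that solves (1 - xt)h = f for h.
  [1-_t]⁻¹ : Carrier → Series → Series
  [1- x t]⁻¹ f zero    = f zero
  [1- x t]⁻¹ f (suc m) = f (suc m) + x * [1- x t]⁻¹ f m

  [1-_t] : Carrier → Series → Series
  [1- x t] = [1- x t^ 1 ]

  -- Serves where two series agree only up to degree m, as truncated convolutions do.
  shift-local : ∀ n m {f g} → (∀ {i} → i ℕ.≤ m → f i ≈ g i) → shift n f m ≈ shift n g m
  shift-local zero    m       f≈g = f≈g ℕ.≤-refl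
  shift-local (suc n) zero    f≈g = refl
  shift-local (suc n) (suc m) f≈g = shift-local n m (λ i≤m → f≈g (ℕ.m≤n⇒m≤1+n i≤m))

  shift-cong : ∀ n {f g} → f ≐ g → shift n f ≐ shift n g
  shift-cong n f≐g m = shift-local n m (λ {i} _ → f≐g i)

  shift-shift : ∀ n f → shift n (shift 1 f) ≐ shift (suc n) f
  shift-shift zero    f zero    = refl
  shift-shift zero    f (suc m) = refl
  shift-shift (suc n) f zero    = refl
  shift-shift (suc n) f (suc m) = shift-shift n f m

  shift-+ : ∀ n f m → shift n f (n ℕ.+ m) ≈ f m
  shift-+ zero    f m = refl
  shift-+ (suc n) f m = shift-+ n f m

  shift-≥ : ∀ n f {m} → n ℕ.≤ m → shift n f m ≈ f (m ℕ.∸ n)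
  shift-≥ n f {m} n≤m = trans (reflexive (≡.cong (shift n f) (≡.sym (ℕ.m+[n∸m]≡n n≤m)))) (shift-+ n f (m ℕ.∸ n))

  shift-< : ∀ n f {m} → m ℕ.< n → shift n f m ≈ 0#
  shift-< (suc n) f {zero}  m<n = refl
  shift-< (suc n) f {suc m} m<n = shift-< n f (ℕ.s≤s⁻¹ m<n)

  shift-zero : ∀ n {f} → (∀ m → f m ≈ 0#) → ∀ m → shift n f m ≈ 0#
  shift-zero zero    f≈0 m       = f≈0 m
  shift-zero (suc n) f≈0 zero    = refl
  shift-zero (suc n) f≈0 (suc m) = shift-zero n f≈0 m

  -[]-cong : ∀ a {f f′ g g′} → f ≐ f′ → g ≐ g′ → f -[ a ] g ≐ f′ -[ a ] g′
  -[]-cong a f≐f′ g≐g′ m = +-cong (f≐f′ m) (-‿cong (*-congˡ (g≐g′ m)))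

  shift--[] : ∀ n f a g → shift n (f -[ a ] g) ≐ shift n f -[ a ] shift n g
  shift--[] zero    f a g m       = refl
  shift--[] (suc n) f a g zero    = solve 1 (λ a → con (+ 0) := con (+ 0) :- a :* con (+ 0)) refl a
  shift--[] (suc n) f a g (suc m) = shift--[] n f a g m

  [1-t^]-local : ∀ a n m {f g} → (∀ {i} → i ℕ.≤ m → f i ≈ g i) →
                 [1- a t^ n ] f m ≈ [1- a t^ n ] g m
  [1-t^]-local a n m f≈g =
    +-cong (f≈g ℕ.≤-refl) (-‿cong (*-congˡ (shift-local n m f≈g)))

  [1-t^]-cong : ∀ a n {f g} → f ≐ g → [1- a t^ n ] f ≐ [1- a t^ n ] g
  [1-t^]-cong a n f≐g m = [1-t^]-local a n m (λ {i} _ → f≐g i)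

  [1-t^]-congˡ : ∀ {a b} n f → a ≈ b → [1- a t^ n ] f ≐ [1- b t^ n ] f
  [1-t^]-congˡ n f a≈b m = +-congˡ (-‿cong (*-congʳ a≈b))

  -- The exponent is positive, so coefficient m of the shifted series involves only coefficients
  -- below m, and f is recovered from its image by strong induction. This takes the place of
  -- division by 1 - atⁿ⁺¹.
  [1-t^]-injective : ∀ a n {f g} →
    [1- a t^ suc n ] f ≐ [1- a t^ suc n ] g → f ≐ g
  [1-t^]-injective a n {f} {g} eq m = below (suc m) (ℕ.n<1+n m)
    where
    recover : ∀ h m → h m ≈ [1- a t^ suc n ] h m + a * shift (suc n) h m
    recover h m = solve 2 (λ u v → u := u :- v :+ v) refl (h m) (a * shift (suc n) h m)

    shift-below : ∀ m → (∀ {i} → i ℕ.< m → f i ≈ g i) → shift (suc n) f m ≈ shift (suc n) g m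
    shift-below zero    f≈g = refl
    shift-below (suc m) f≈g = shift-local n m (λ i≤m → f≈g (ℕ.s≤s i≤m))

    below : ∀ M {m} → m ℕ.< M → f m ≈ g m
    below (suc M) {m} m<1+M = begin
      f m                                              ≈⟨ recover f m ⟩
      [1- a t^ suc n ] f m + a * shift (suc n) f m     ≈⟨ +-cong (eq m) (*-congˡ (shift-below m (λ i<m →
                                                             below M (ℕ.<-≤-trans i<m (ℕ.s≤s⁻¹ m<1+M))))) ⟩
      [1- a t^ suc n ] g m + a * shift (suc n) g m     ≈⟨ recover g m ⟨
      g m                                              ∎

  [1-t]-inverse : ∀ x f → [1- x t] ([1- x t]⁻¹ f) ≐ f
  [1-t]-inverse x f zero    = solve 2 (λ x u → u :- x :* con (+ 0) := u) refl x (f 0)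
  [1-t]-inverse x f (suc m) =
    solve 3 (λ x u v → u :+ x :* v :- x :* v := u) refl x (f (suc m)) ([1- x t]⁻¹ f m)

  [1-t]-comm : ∀ x y f → [1- x t] ([1- y t] f) ≐ [1- y t] ([1- x t] f)
  [1-t]-comm x y f zero =
    solve 3 (λ x y u → u :- y :* con (+ 0) :- x :* con (+ 0)
                    := u :- x :* con (+ 0) :- y :* con (+ 0)) refl x y (f 0)
  [1-t]-comm x y f (suc m) =
    solve 5 (λ x y u v w → u :- y :* v :- x :* (v :- y :* w) := u :- x :* v :- y :* (v :- x :* w))
      refl x y (f (suc m)) (f m) (shift 1 f m)

  infixr 5 ∏[1-_t]_ ∏[1-_t]⁻¹_
  -- The fold starts from an arbitrary series, so that the product over a concatenation of vectors
  -- is an iterated product.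
  ∏[1-_t]_ : ∀ {r} → Vector Carrier r → Series → Series
  ∏[1- z t] f = Vector.foldr [1-_t] f z

  ∏[1-_t]⁻¹_ : ∀ {r} → Vector Carrier r → Series → Series
  ∏[1- z t]⁻¹ f = Vector.foldr [1-_t]⁻¹ f z

  ∏-cong : ∀ {r} (z : Vector Carrier r) {f g} → f ≐ g → ∏[1- z t] f ≐ ∏[1- z t] g
  ∏-cong {zero}  z f≐g = f≐g
  ∏-cong {suc r} z f≐g = [1-t^]-cong (head z) 1 (∏-cong (tail z) f≐g)

  ∏-[1-t] : ∀ {r} (z : Vector Carrier r) x f → ∏[1- z t] [1- x t] f ≐ [1- x t] (∏[1- z t] f)
  ∏-[1-t] {zero}  z x f m = refl
  ∏-[1-t] {suc r} z x f m =
    trans ([1-t^]-cong (head z) 1 (∏-[1-t] (tail z) x f) m)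
          ([1-t]-comm (head z) x (∏[1- tail z t] f) m)

  -- A fold exposes the first factor; the product over ζ, ..., ζⁿ has to be relieved of its last
  -- one.
  ∏-last : ∀ r (u : ℕ → Carrier) f →
    ∏[1- (λ (i : Fin (suc r)) → u (toℕ i)) t] f
      ≐ [1- u r t] (∏[1- (λ (i : Fin r) → u (toℕ i)) t] f)
  ∏-last zero    u f m = refl
  ∏-last (suc r) u f m =
    trans ([1-t^]-cong (u 0) 1 (∏-last r (λ i → u (suc i)) f) m)
          ([1-t]-comm (u 0) (u (suc r)) _ m)

  -- Both products nest their factors in the same order, so the head factor must first commute past
  -- the tail to meet its inverse.
  ∏-inverse : ∀ {r} (z : Vector Carrier r) f → ∏[1- z t] ∏[1- z t]⁻¹ f ≐ f
  ∏-inverse {zero}  z f m = refl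
  ∏-inverse {suc r} z f m = begin
    [1- head z t] (∏[1- tail z t] [1- head z t]⁻¹ h) m   ≈⟨ ∏-[1-t] (tail z) (head z) _ m ⟨
    (∏[1- tail z t] [1- head z t] ([1- head z t]⁻¹ h)) m ≈⟨ ∏-cong (tail z) ([1-t]-inverse (head z) h) m ⟩
    (∏[1- tail z t] h) m                                 ≈⟨ ∏-inverse (tail z) f m ⟩
    f m                                                  ∎
    where h = ∏[1- tail z t]⁻¹ f

  [1-t]-constant : ∀ x f → [1- x t] f 0 ≈ f 0
  [1-t]-constant x f = solve 2 (λ x u → u :- x :* con (+ 0) := u) refl x (f 0)

  ∏-constant : ∀ {r} (z : Vector Carrier r) f → (∏[1- z t] f) 0 ≈ f 0
  ∏-constant {zero}  z f = refl
  ∏-constant {suc r} z f = trans ([1-t]-constant (head z) (∏[1- tail z t] f)) (∏-constant (tail z) f)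

  ∏-degree : ∀ {r} (z : Vector Carrier r) {m} → r ℕ.< m → (∏[1- z t] 𝟙) m ≈ 0#
  ∏-degree {zero}  z {suc m} r<m = refl
  ∏-degree {suc r} z {suc m} r<m = begin
    (∏[1- tail z t] 𝟙) (suc m) - head z * (∏[1- tail z t] 𝟙) m
      ≈⟨ +-cong (∏-degree (tail z) (ℕ.m≤n⇒m≤1+n (ℕ.s≤s⁻¹ r<m)))
                (-‿cong (*-congˡ (∏-degree (tail z) (ℕ.s≤s⁻¹ r<m)))) ⟩
    0# - head z * 0#   ≈⟨ solve 1 (λ x → con (+ 0) :- x :* con (+ 0) := con (+ 0)) refl (head z) ⟩
    0#                 ∎

  -- The substitution f(yt).
  dilate : Carrier → Series → Series
  dilate y f m = y ^ m * f m

  dilate-𝟙 : ∀ y → dilate y 𝟙 ≐ 𝟙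
  dilate-𝟙 y zero    = *-identityʳ 1#
  dilate-𝟙 y (suc m) = zeroʳ _

  -- Coefficient form of (yt)ⁿ f(yt) = (tⁿf)(yt), phrased without the exponent m - n.
  dilate-shift : ∀ y n f m → y ^ n * shift n (dilate y f) m ≈ y ^ m * shift n f m
  dilate-shift y zero    f m       = *-identityˡ _
  dilate-shift y (suc n) f zero    = trans (zeroʳ _) (sym (zeroʳ _))
  dilate-shift y (suc n) f (suc m) = begin
    y * y ^ n * shift n (dilate y f) m     ≈⟨ *-assoc _ _ _ ⟩
    y * (y ^ n * shift n (dilate y f) m)   ≈⟨ *-congˡ (dilate-shift y n f m) ⟩
    y * (y ^ m * shift n f m)              ≈⟨ *-assoc _ _ _ ⟨
    y * y ^ m * shift n f m                ∎

  dilate-[1-t^] : ∀ y a n f → [1- y ^ n * a t^ n ] (dilate y f) ≐ dilate y ([1- a t^ n ] f)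
  dilate-[1-t^] y a n f m = begin
    y ^ m * f m - y ^ n * a * s          ≈⟨ +-congˡ (-‿cong (solve 3 (λ p a s → p :* a :* s := a :* (p :* s)) refl (y ^ n) a s)) ⟩
    y ^ m * f m - a * (y ^ n * s)        ≈⟨ +-congˡ (-‿cong (*-congˡ (dilate-shift y n f m))) ⟩
    y ^ m * f m - a * (y ^ m * s′)       ≈⟨ solve 4 (λ p u a s → p :* u :- a :* (p :* s) := p :* (u :- a :* s)) refl (y ^ m) (f m) a s′ ⟩
    y ^ m * (f m - a * s′)               ∎
    where
    s  = shift n (dilate y f) m
    s′ = shift n f m

  dilate-∏ : ∀ {r} y (z : Vector Carrier r) f →
    ∏[1- (λ i → y * z i) t] dilate y f ≐ dilate y (∏[1- z t] f)
  dilate-∏ {zero}  y z f m = refl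
  dilate-∏ {suc r} y z f m = begin
    [1- y * head z t] (∏[1- (λ i → y * tail z i) t] dilate y f) m
      ≈⟨ [1-t^]-cong (y * head z) 1 (dilate-∏ y (tail z) f) m ⟩
    [1- y * head z t] (dilate y (∏[1- tail z t] f)) m
      ≈⟨ [1-t^]-congˡ 1 (dilate y (∏[1- tail z t] f)) (*-congʳ (sym (*-identityʳ y))) m ⟩
    [1- y ^ 1 * head z t] (dilate y (∏[1- tail z t] f)) m
      ≈⟨ dilate-[1-t^] y (head z) 1 (∏[1- tail z t] f) m ⟩
    dilate y ([1- head z t] (∏[1- tail z t] f)) m ∎

  -- Σ_{j ≤ N} g_j t^{nj} f
  partialConv : ℕ → ℕ → Series → Series → Series
  partialConv n zero    f g m = g 0 * f m
  partialConv n (suc N) f g m = g 0 * f m + shift n (partialConv n N f (λ j → g (suc j))) m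

  -- f(t) g(tⁿ); meaningful for n > 0, when the terms with j > m do not
  -- contribute to the coefficient of tᵐ.
  conv : ℕ → Series → Series → Series
  conv n f g m = partialConv n m f g m

  partialConv-cong : ∀ n N {f f′ g g′} → f ≐ f′ → g ≐ g′ →
    partialConv n N f g ≐ partialConv n N f′ g′
  partialConv-cong n zero    f≐f′ g≐g′ m = *-cong (g≐g′ 0) (f≐f′ m)
  partialConv-cong n (suc N) f≐f′ g≐g′ m =
    +-cong (*-cong (g≐g′ 0) (f≐f′ m))
           (shift-cong n (partialConv-cong n N f≐f′ (λ j → g≐g′ (suc j))) m)

  conv-cong : ∀ n {f f′ g g′} → f ≐ f′ → g ≐ g′ → conv n f g ≐ conv n f′ g′
  conv-cong n f≐f′ g≐g′ m = partialConv-cong n m f≐f′ g≐g′ m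

  -- The additional term is a multiple of t to the power (n + 1)(N + 1), which exceeds N and hence
  -- m.
  partialConv-suc : ∀ n N f g {m} → m ℕ.≤ N →
    partialConv (suc n) (suc N) f g m ≈ partialConv (suc n) N f g m
  partialConv-suc n zero    f g {zero}  m≤N = +-identityʳ _
  partialConv-suc n (suc N) f g {zero}  m≤N = refl
  partialConv-suc n (suc N) f g {suc m} m≤N = +-congˡ (shift-local n m
    (λ i≤m → partialConv-suc n N f (λ j → g (suc j)) (ℕ.≤-trans i≤m (ℕ.s≤s⁻¹ m≤N))))

  partialConv-stable : ∀ n {N m} f g → m ℕ.≤ N →
    partialConv (suc n) N f g m ≈ conv (suc n) f g m
  partialConv-stable n {N} {m} f g m≤N = go (ℕ.≤⇒≤′ m≤N)
    where
    go : ∀ {N} → m ℕ.≤′ N → partialConv (suc n) N f g m ≈ conv (suc n) f g m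
    go (ℕ.≤′-reflexive ≡.refl) = refl
    go (ℕ.≤′-step m≤′N) = trans (partialConv-suc n _ f g (ℕ.≤′⇒≤ m≤′N)) (go m≤′N)

  partialConv-shiftˡ : ∀ n N f g → partialConv n N (shift 1 f) g ≐ shift 1 (partialConv n N f g)
  partialConv-shiftˡ n zero    f g zero    = zeroʳ _
  partialConv-shiftˡ n zero    f g (suc m) = refl
  partialConv-shiftˡ n (suc N) f g m       = trans
    (+-congˡ (trans (shift-cong n (partialConv-shiftˡ n N f (λ j → g (suc j))) m)
                    (shift-shift n _ m)))
    (split m)
    where
    split : ∀ m → g 0 * shift 1 f m + shift (suc n) (partialConv n N f (λ j → g (suc j))) m
                    ≈ shift 1 (partialConv n (suc N) f g) m
    split zero    = solve 1 (λ a → a :* con (+ 0) :+ con (+ 0) := con (+ 0)) refl (g 0)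
    split (suc m) = refl

  partialConv--[]ˡ : ∀ n N f a f′ g →
    partialConv n N (f -[ a ] f′) g ≐ partialConv n N f g -[ a ] partialConv n N f′ g
  partialConv--[]ˡ n zero f a f′ g m =
    solve 4 (λ b u a v → b :* (u :- a :* v) := b :* u :- a :* (b :* v)) refl (g 0) (f m) a (f′ m)
  partialConv--[]ˡ n (suc N) f a f′ g m = trans
    (+-congˡ (trans (shift-cong n (partialConv--[]ˡ n N f a f′ (λ j → g (suc j))) m)
                    (shift--[] n _ a _ m)))
    (solve 6 (λ b u a v p q → b :* (u :- a :* v) :+ (p :- a :* q) := b :* u :+ p :- a :* (b :* v :+ q))
      refl (g 0) (f m) a (f′ m) _ _)

  partialConv--[]ʳ : ∀ n N f g a g′ →
    partialConv n N f (g -[ a ] g′) ≐ partialConv n N f g -[ a ] partialConv n N f g′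
  partialConv--[]ʳ n zero f g a g′ m =
    solve 4 (λ u b a c → (b :- a :* c) :* u := b :* u :- a :* (c :* u)) refl (f m) (g 0) a (g′ 0)
  partialConv--[]ʳ n (suc N) f g a g′ m = trans
    (+-congˡ (trans (shift-cong n (partialConv--[]ʳ n N f (λ j → g (suc j)) a (λ j → g′ (suc j))) m)
                    (shift--[] n _ a _ m)))
    (solve 6 (λ u b a c p q → (b :- a :* c) :* u :+ (p :- a :* q) := b :* u :+ p :- a :* (c :* u :+ q))
      refl (f m) (g 0) a (g′ 0) _ _)

  partialConv-zeroʳ : ∀ n N f {g} → (∀ j → g j ≈ 0#) → ∀ m → partialConv n N f g m ≈ 0#
  partialConv-zeroʳ n zero    f g≈0 m = trans (*-congʳ (g≈0 0)) (zeroˡ _)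
  partialConv-zeroʳ n (suc N) f g≈0 m = trans
    (+-cong (trans (*-congʳ (g≈0 0)) (zeroˡ _))
            (shift-zero n (partialConv-zeroʳ n N f (λ j → g≈0 (suc j))) m))
    (+-identityʳ 0#)

  conv-𝟙ʳ : ∀ n f → conv n f 𝟙 ≐ f
  conv-𝟙ʳ n f zero    = *-identityˡ _
  conv-𝟙ʳ n f (suc m) = trans
    (+-cong (*-identityˡ _) (shift-zero n (partialConv-zeroʳ n m f (λ _ → refl)) (suc m)))
    (+-identityʳ _)

  conv-[1-t]ˡ : ∀ n x f g → conv (suc n) ([1- x t] f) g ≐ [1- x t] (conv (suc n) f g)
  conv-[1-t]ˡ n x f g m = begin
    partialConv (suc n) m ([1- x t] f) g m
      ≈⟨ partialConv--[]ˡ (suc n) m f x (shift 1 f) g m ⟩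
    (partialConv (suc n) m f g -[ x ] partialConv (suc n) m (shift 1 f) g) m
      ≈⟨ -[]-cong x {partialConv (suc n) m f g} (λ _ → refl) (partialConv-shiftˡ (suc n) m f g) m ⟩
    [1- x t] (partialConv (suc n) m f g) m
      -- The shift reads degree m - 1 of a convolution truncated at m; stability replaces this by
      -- the truncation at m - 1 that `conv` prescribes.
      ≈⟨ [1-t^]-local x 1 m (partialConv-stable n f g) ⟩
    [1- x t] (conv (suc n) f g) m ∎

  -- A factor t of g becomes tⁿ⁺¹ in f(t) g(tⁿ⁺¹).
  conv-shiftʳ : ∀ n f g → conv (suc n) f (shift 1 g) ≐ shift (suc n) (conv (suc n) f g)
  conv-shiftʳ n f g zero    = zeroˡ _
  conv-shiftʳ n f g (suc m) = begin
    0# * f (suc m) + shift n (partialConv (suc n) m f g) m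
      ≈⟨ trans (+-congʳ (zeroˡ _)) (+-identityˡ _) ⟩
    shift n (partialConv (suc n) m f g) m
      ≈⟨ shift-local n m (partialConv-stable n f g) ⟩
    shift n (conv (suc n) f g) m ∎

  conv-shiftʳ-1 : ∀ n f g → conv 1 f (shift n g) ≐ shift n (conv 1 f g)
  conv-shiftʳ-1 zero    f g m = refl
  conv-shiftʳ-1 (suc n) f g m = begin
    conv 1 f (shift (suc n) g) m       ≈⟨ conv-cong 1 (λ _ → refl) (shift-suc n g) m ⟩
    conv 1 f (shift 1 (shift n g)) m   ≈⟨ conv-shiftʳ 0 f (shift n g) m ⟩
    shift 1 (conv 1 f (shift n g)) m   ≈⟨ shift-cong 1 (conv-shiftʳ-1 n f g) m ⟩
    shift 1 (shift n (conv 1 f g)) m   ≈⟨ shift-suc n (conv 1 f g) m ⟨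
    shift (suc n) (conv 1 f g) m       ∎
    where
    shift-suc : ∀ n f → shift (suc n) f ≐ shift 1 (shift n f)
    shift-suc n f zero    = refl
    shift-suc n f (suc m) = refl

  conv-[1-t]ʳ : ∀ n a f g → conv (suc n) f ([1- a t] g) ≐ [1- a t^ suc n ] (conv (suc n) f g)
  conv-[1-t]ʳ n a f g m = trans
    (partialConv--[]ʳ (suc n) m f g a (shift 1 g) m)
    (-[]-cong a {conv (suc n) f g} (λ _ → refl) (conv-shiftʳ n f g) m)

  conv-[1-t^]ʳ-1 : ∀ n a f g → conv 1 f ([1- a t^ n ] g) ≐ [1- a t^ n ] (conv 1 f g)
  conv-[1-t^]ʳ-1 n a f g m = trans
    (partialConv--[]ʳ 1 m f g a (shift n g) m)
    (-[]-cong a {conv 1 f g} (λ _ → refl) (conv-shiftʳ-1 n f g) m)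

  -- Turns an operator applied to f into the product of f with a fixed polynomial. In this way an
  -- identity between operators that is known at `𝟙` carries over to every series.
  conv-∏ : ∀ {r} (z : Vector Carrier r) f → conv 1 f (∏[1- z t] 𝟙) ≐ ∏[1- z t] f
  conv-∏ {zero}  z f m = conv-𝟙ʳ 1 f m
  conv-∏ {suc r} z f m = trans
    (conv-[1-t]ʳ 0 (head z) f (∏[1- tail z t] 𝟙) m)
    ([1-t^]-cong (head z) 1 (conv-∏ (tail z) f) m)

-- Sums over initial segments and the Cauchy product of finite sums.

module InitialSums {c ℓ} (R : CommutativeRing c ℓ) where
  open CommutativeRing R hiding (zero)
  open SymmetricPolynomials rawRing using (sum; ∑[0⋯_]_)
  open IntegerSolver R using (solve; _:=_; _:+_; _:*_; con)
  open SemiringSum semiring using (sum-cong-≋; *-distribˡ-sum; *-distribʳ-sum; ∑-distrib-+)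
  open SetoidReasoning setoid

  ∑-cong-≤ : ∀ t {F G} → (∀ {j} → j ℕ.≤ t → F j ≈ G j) → ∑[0⋯ t ] F ≈ ∑[0⋯ t ] G
  ∑-cong-≤ t F≈G = sum-cong-≋ {suc t} (λ j → F≈G (Fin.toℕ≤pred[n] j))

  ∑-+ : ∀ t F G → ∑[0⋯ t ] (λ j → F j + G j) ≈ ∑[0⋯ t ] F + ∑[0⋯ t ] G
  ∑-+ t F G = ∑-distrib-+ {suc t} (λ j → F (toℕ j)) (λ j → G (toℕ j))

  *-∑ : ∀ t x F → x * ∑[0⋯ t ] F ≈ ∑[0⋯ t ] (λ j → x * F j)
  *-∑ t x F = *-distribˡ-sum {suc t} x (λ j → F (toℕ j))

  ∑-* : ∀ t F x → ∑[0⋯ t ] F * x ≈ ∑[0⋯ t ] (λ j → F j * x)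
  ∑-* t F x = *-distribʳ-sum {suc t} x (λ j → F (toℕ j))

  ∑-zero : ∀ r {F : ℕ → Carrier} → (∀ {j} → j ℕ.< r → F j ≈ 0#) → sum {r} (λ j → F (toℕ j)) ≈ 0#
  ∑-zero zero    F≈0 = refl
  ∑-zero (suc r) F≈0 = trans (+-cong (F≈0 (ℕ.s≤s ℕ.z≤n)) (∑-zero r (λ j<r → F≈0 (ℕ.s≤s j<r)))) (+-identityʳ 0#)

  ∑-extend : ∀ {t t′} F → t ℕ.≤ t′ → (∀ {j} → t ℕ.< j → F j ≈ 0#) → ∑[0⋯ t ] F ≈ ∑[0⋯ t′ ] F
  ∑-extend {zero}  {t′} F t≤t′ F≈0 = +-congˡ (sym (∑-zero t′ (λ {j} _ → F≈0 {suc j} (ℕ.s≤s ℕ.z≤n))))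
  ∑-extend {suc t} {suc t′} F t≤t′ F≈0 =
    +-congˡ (∑-extend (λ j → F (suc j)) (ℕ.s≤s⁻¹ t≤t′) (λ t<j → F≈0 (ℕ.s≤s t<j)))

  ∑-last : ∀ t F → ∑[0⋯ suc t ] F ≈ ∑[0⋯ t ] F + F (suc t)
  ∑-last zero    F = solve 2 (λ u v → u :+ (v :+ con (+ 0)) := u :+ con (+ 0) :+ v) refl (F 0) (F 1)
  ∑-last (suc t) F = trans (+-congˡ (∑-last t (λ j → F (suc j)))) (sym (+-assoc _ _ _))

  -- Both sides sum aᵢbⱼ over the triangle i + j ≤ N, by rows and by antidiagonals. Passing from N
  -- to N + 1 adds the antidiagonal i + j = N + 1, whose last entry is the `corner`.
  ∑-triangle : ∀ N (a b : ℕ → Carrier) →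
    ∑[0⋯ N ] (λ i → a i * ∑[0⋯ N ℕ.∸ i ] b) ≈ ∑[0⋯ N ] (λ k → ∑[0⋯ k ] (λ i → a i * b (k ℕ.∸ i)))
  ∑-triangle zero    a b =
    solve 2 (λ u v → u :* (v :+ con (+ 0)) :+ con (+ 0) := u :* v :+ con (+ 0) :+ con (+ 0)) refl (a 0) (b 0)
  ∑-triangle (suc N) a b = begin
    ∑[0⋯ suc N ] (λ i → a i * ∑[0⋯ suc N ℕ.∸ i ] b)
      ≈⟨ ∑-last N (λ i → a i * ∑[0⋯ suc N ℕ.∸ i ] b) ⟩
    ∑[0⋯ N ] (λ i → a i * ∑[0⋯ suc N ℕ.∸ i ] b) + a (suc N) * ∑[0⋯ suc N ℕ.∸ suc N ] b
      ≈⟨ +-cong (∑-cong-≤ N step) corner ⟩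
    ∑[0⋯ N ] (λ i → a i * ∑[0⋯ N ℕ.∸ i ] b + a i * b (suc N ℕ.∸ i)) + a (suc N) * b (N ℕ.∸ N)
      ≈⟨ +-congʳ (∑-+ N (λ i → a i * ∑[0⋯ N ℕ.∸ i ] b) (λ i → a i * b (suc N ℕ.∸ i))) ⟩
    ∑[0⋯ N ] (λ i → a i * ∑[0⋯ N ℕ.∸ i ] b) + ∑[0⋯ N ] (λ i → a i * b (suc N ℕ.∸ i)) + a (suc N) * b (N ℕ.∸ N)
      ≈⟨ +-assoc _ _ _ ⟩
    ∑[0⋯ N ] (λ i → a i * ∑[0⋯ N ℕ.∸ i ] b) + (∑[0⋯ N ] (λ i → a i * b (suc N ℕ.∸ i)) + a (suc N) * b (N ℕ.∸ N))
      ≈⟨ +-cong (∑-triangle N a b) (sym (∑-last N (λ i → a i * b (suc N ℕ.∸ i)))) ⟩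
    ∑[0⋯ N ] conv + conv (suc N)
      ≈⟨ ∑-last N conv ⟨
    ∑[0⋯ suc N ] conv ∎
    where
    conv : ℕ → Carrier
    conv k = ∑[0⋯ k ] (λ i → a i * b (k ℕ.∸ i))

    step : ∀ {i} → i ℕ.≤ N →
      a i * ∑[0⋯ suc N ℕ.∸ i ] b ≈ a i * ∑[0⋯ N ℕ.∸ i ] b + a i * b (suc N ℕ.∸ i)
    step {i} i≤N = begin
      a i * ∑[0⋯ suc N ℕ.∸ i ] b
        ≡⟨ ≡.cong (λ j → a i * ∑[0⋯ j ] b) (ℕ.+-∸-assoc 1 i≤N) ⟩
      a i * ∑[0⋯ suc (N ℕ.∸ i) ] b
        ≈⟨ *-congˡ (∑-last (N ℕ.∸ i) b) ⟩
      a i * (∑[0⋯ N ℕ.∸ i ] b + b (suc (N ℕ.∸ i)))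
        ≈⟨ distribˡ _ _ _ ⟩
      a i * ∑[0⋯ N ℕ.∸ i ] b + a i * b (suc (N ℕ.∸ i))
        ≡⟨ ≡.cong (λ j → a i * ∑[0⋯ N ℕ.∸ i ] b + a i * b j) (ℕ.+-∸-assoc 1 i≤N) ⟨
      a i * ∑[0⋯ N ℕ.∸ i ] b + a i * b (suc N ℕ.∸ i) ∎

    corner : a (suc N) * ∑[0⋯ suc N ℕ.∸ suc N ] b ≈ a (suc N) * b (N ℕ.∸ N)
    corner rewrite ℕ.n∸n≡0 N = *-congˡ (+-identityʳ (b 0))

-- Truncated exponential series in a commutative ring.

module FormalExponential {c ℓ} (R : CommutativeRing c ℓ) where
  open CommutativeRing R hiding (zero)
  open SymmetricPolynomials rawRing using (_^_; ∑[0⋯_]_)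
  open import Data.Nat.Combinatorics using (_C_; nCk≡n!/k![n-k]!; k![n∸k]!∣n!)
  open IntegerSolver R using (solve; _:=_; _:+_; _:*_; _:-_; :-_; con)
  open InitialSums R
  open SemiringMult semiring using (×1-homo-*; ×-assoc-*; ×-congʳ) renaming (_×_ to _⋆_)
  open SetoidReasoning setoid

  -- `r n` stands for 1/n!, characterised by n! · `r n` = 1.
  module _ (r : ℕ → Carrier) (n!r≈1 : ∀ n → (n !) ⋆ 1# * r n ≈ 1#) where

    term : Carrier → ℕ → Carrier
    term z j = r j * z ^ j

    expTo : Carrier → ℕ → Carrier
    expTo z N = ∑[0⋯ N ] term z

    -- Inserting 1 = k! · `r k` and 1 = (n - k)! · `r (n ∸ k)` on the left lets the factorials
    -- combine with the binomial coefficient to n!, which cancels `r n`.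
    r-binomial : ∀ {n k} → k ℕ.≤ n → r n * (n C k) ⋆ 1# ≈ r k * r (n ℕ.∸ k)
    r-binomial {n} {k} k≤n = begin
      r n * nCk
        ≈⟨ solve 2 (λ u v → u :* v := u :* v :* (con (+ 1) :* con (+ 1))) refl (r n) nCk ⟩
      r n * nCk * (1# * 1#)
        ≈⟨ *-congˡ (*-cong (n!r≈1 k) (n!r≈1 (n ℕ.∸ k))) ⟨
      r n * nCk * ((k !) ⋆ 1# * r k * (((n ℕ.∸ k) !) ⋆ 1# * r (n ℕ.∸ k)))
        ≈⟨ solve 6 (λ u v a b c d → u :* v :* (a :* b :* (c :* d)) := v :* (a :* c) :* u :* (b :* d)) refl
             (r n) nCk ((k !) ⋆ 1#) (r k) (((n ℕ.∸ k) !) ⋆ 1#) (r (n ℕ.∸ k)) ⟩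
      nCk * ((k !) ⋆ 1# * ((n ℕ.∸ k) !) ⋆ 1#) * r n * (r k * r (n ℕ.∸ k))
        ≈⟨ *-congʳ (*-congʳ factorials) ⟩
      (n !) ⋆ 1# * r n * (r k * r (n ℕ.∸ k))
        ≈⟨ *-congʳ (n!r≈1 n) ⟩
      1# * (r k * r (n ℕ.∸ k))
        ≈⟨ *-identityˡ _ ⟩
      r k * r (n ℕ.∸ k) ∎
      where
      nCk = (n C k) ⋆ 1#

      nCk*k![n∸k]!≡n! : (n C k) ℕ.* (k ! ℕ.* (n ℕ.∸ k) !) ≡ n !
      nCk*k![n∸k]!≡n! = ≡.trans (≡.cong (ℕ._* (k ! ℕ.* (n ℕ.∸ k) !)) (nCk≡n!/k![n-k]! k≤n))
        (ℕ.m/n*n≡m {{ℕ.m*n≢0 (k !) ((n ℕ.∸ k) !) {{k ℕ.!≢0}} {{(n ℕ.∸ k) ℕ.!≢0}}}} (k![n∸k]!∣n! k≤n))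

      factorials : nCk * ((k !) ⋆ 1# * ((n ℕ.∸ k) !) ⋆ 1#) ≈ (n !) ⋆ 1#
      factorials = begin
        nCk * ((k !) ⋆ 1# * ((n ℕ.∸ k) !) ⋆ 1#)      ≈⟨ *-congˡ (×1-homo-* (k !) ((n ℕ.∸ k) !)) ⟨
        nCk * (k ! ℕ.* (n ℕ.∸ k) !) ⋆ 1#             ≈⟨ ×1-homo-* (n C k) (k ! ℕ.* (n ℕ.∸ k) !) ⟨
        ((n C k) ℕ.* (k ! ℕ.* (n ℕ.∸ k) !)) ⋆ 1#   ≡⟨ ≡.cong (_⋆ 1#) nCk*k![n∸k]!≡n! ⟩
        (n !) ⋆ 1#                                 ∎

    term-+ : ∀ z w n → ∑[0⋯ n ] (λ k → term z k * term w (n ℕ.∸ k)) ≈ term (z + w) n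
    term-+ z w n = begin
      ∑[0⋯ n ] (λ k → term z k * term w (n ℕ.∸ k))
        ≈⟨ ∑-cong-≤ n step ⟩
      ∑[0⋯ n ] (λ k → r n * ((n C k) ⋆ (z ^ k * w ^ (n ℕ.∸ k))))
        ≈⟨ *-∑ n (r n) (λ k → (n C k) ⋆ (z ^ k * w ^ (n ℕ.∸ k))) ⟨
      r n * ∑[0⋯ n ] (λ k → (n C k) ⋆ (z ^ k * w ^ (n ℕ.∸ k)))
        ≈⟨ *-congˡ (Binomial.theorem commutativeSemiring n z w) ⟨
      r n * (z + w) ^ n ∎
      where
      step : ∀ {k} → k ℕ.≤ n →
        term z k * term w (n ℕ.∸ k) ≈ r n * ((n C k) ⋆ (z ^ k * w ^ (n ℕ.∸ k)))
      step {k} k≤n = begin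
        r k * z ^ k * (r (n ℕ.∸ k) * w ^ (n ℕ.∸ k))
          ≈⟨ solve 4 (λ a b c d → a :* b :* (c :* d) := a :* c :* (b :* d)) refl
               (r k) (z ^ k) (r (n ℕ.∸ k)) (w ^ (n ℕ.∸ k)) ⟩
        r k * r (n ℕ.∸ k) * (z ^ k * w ^ (n ℕ.∸ k))
          ≈⟨ *-congʳ (r-binomial k≤n) ⟨
        r n * (n C k) ⋆ 1# * (z ^ k * w ^ (n ℕ.∸ k))
          ≈⟨ *-assoc _ _ _ ⟩
        r n * ((n C k) ⋆ 1# * (z ^ k * w ^ (n ℕ.∸ k)))
          ≈⟨ *-congˡ (trans (×-assoc-* (n C k) 1# _) (×-congʳ (n C k) (*-identityˡ _))) ⟩
        r n * ((n C k) ⋆ (z ^ k * w ^ (n ℕ.∸ k))) ∎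

    -- The product runs over the square i, j ≤ N. By the binomial theorem the series of z + w runs
    -- over the triangle i + j ≤ N, so row i of the difference is a stretch of the tail of the
    -- series of w.
    expTo-+ : ∀ z w N →
      expTo z N * expTo w N - expTo (z + w) N
        ≈ ∑[0⋯ N ] (λ i → term z i * (expTo w N - expTo w (N ℕ.∸ i)))
    expTo-+ z w N = begin
      expTo z N * expTo w N - expTo (z + w) N
        ≈⟨ +-cong (∑-* N (term z) (expTo w N)) (-‿cong (sym triangle)) ⟩
      ∑[0⋯ N ] F - ∑[0⋯ N ] G
        ≈⟨ +-congʳ (∑-cong-≤ N (λ {i} _ → solve 3 (λ a u v → a :* u := a :* (u :- v) :+ a :* v) refl
             (term z i) (expTo w N) (expTo w (N ℕ.∸ i)))) ⟩
      ∑[0⋯ N ] (λ i → H i + G i) - ∑[0⋯ N ] G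
        ≈⟨ +-congʳ (∑-+ N H G) ⟩
      ∑[0⋯ N ] H + ∑[0⋯ N ] G - ∑[0⋯ N ] G
        ≈⟨ solve 2 (λ h g → h :+ g :- g := h) refl (∑[0⋯ N ] H) (∑[0⋯ N ] G) ⟩
      ∑[0⋯ N ] H ∎
      where
      F G H : ℕ → Carrier
      F i = term z i * expTo w N
      G i = term z i * expTo w (N ℕ.∸ i)
      H i = term z i * (expTo w N - expTo w (N ℕ.∸ i))

      triangle : ∑[0⋯ N ] G ≈ expTo (z + w) N
      triangle = trans (∑-triangle N (term z) (term w)) (∑-cong-≤ N (λ {n} _ → term-+ z w n))

-- Folds over concatenated vectors.

-- Functional vectors that agree pointwise need not be propositionally equal; their folds are.
foldr-cong : ∀ {a b} {A : Set a} {B : Set b} (f : A → B → B) e {n} {u v : Vector A n} →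
  (∀ i → u i ≡ v i) → Vector.foldr f e u ≡ Vector.foldr f e v
foldr-cong f e {zero}  u≡v = ≡.refl
foldr-cong f e {suc n} u≡v = ≡.cong₂ f (u≡v Fin.zero) (foldr-cong f e (λ i → u≡v (Fin.suc i)))

foldr-splitAt : ∀ {a b} {A : Set a} {B : Set b} (f : A → B → B) e m {n} (v : Vector A (m ℕ.+ n)) →
  Vector.foldr f e v
    ≡ Vector.foldr f (Vector.foldr f e (λ j → v (m Fin.↑ʳ j))) (λ i → v (i Fin.↑ˡ n))
foldr-splitAt f e zero    v = ≡.refl
foldr-splitAt f e (suc m) v = ≡.cong (f (v Fin.zero)) (foldr-splitAt f e m (tail v))

-- The Kronecker product is a `concat`; this splits a product over it into one block per entry of ξ.
foldr-concat : ∀ {a b} {A : Set a} {B : Set b} (f : A → B → B) e {m n}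
  (v : Vector (Vector A n) (suc m)) →
  Vector.foldr f e (Vector.concat v)
    ≡ Vector.foldr f (Vector.foldr f e (Vector.concat (tail v))) (head v)
foldr-concat f e {m} {n} v = begin
  Vector.foldr f e (Vector.concat v)
    ≡⟨ foldr-splitAt f e n (Vector.concat v) ⟩
  Vector.foldr f (Vector.foldr f e (Vector.concat v ∘ (n Fin.↑ʳ_))) (Vector.concat v ∘ (Fin._↑ˡ m ℕ.* n))
    ≡⟨ ≡.cong (λ e′ → Vector.foldr f e′ (Vector.concat v ∘ (Fin._↑ˡ m ℕ.* n))) (foldr-cong f e right) ⟩
  Vector.foldr f (Vector.foldr f e (Vector.concat (tail v))) (Vector.concat v ∘ (Fin._↑ˡ m ℕ.* n))
    ≡⟨ foldr-cong f _ left ⟩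
  Vector.foldr f (Vector.foldr f e (Vector.concat (tail v))) (head v) ∎
  where
  open ≡.≡-Reasoning
  left : ∀ i → Vector.concat v (i Fin.↑ˡ m ℕ.* n) ≡ head v i
  left i rewrite Fin.splitAt-↑ˡ n i (m ℕ.* n) = ≡.refl
  right : ∀ j → Vector.concat v (n Fin.↑ʳ j) ≡ Vector.concat (tail v) j
  right j rewrite Fin.splitAt-↑ʳ n (m ℕ.* n) j = ≡.refl

-- Factorisation of 1 - tⁿ and products over ξ ⊗ ζ⃗.

module RootsOfUnity {c ℓ} (R : CommutativeRing c ℓ) where
  open CommutativeRing R hiding (zero)
  open IntegerSolver R using (solve; _:=_; _:+_; _:*_; _:-_; :-_; con)
  open PowerSeries R
  open SemiringExp semiring using (_^_)
  open SetoidReasoning setoid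

  -- A primitive n-th root of unity, n = suc n′, for which 1 - ζ, …, 1 - ζⁿ′
  -- are moreover not zero divisors.
  record IsRegularRoot (n′ : ℕ) (ζ : Carrier) : Set (c ⊔ ℓ) where
    field
      ζⁿ≈1      : ζ ^ suc n′ ≈ 1#
      ζʳa≈a⇒a≈0 : ∀ {r a} → 0 ℕ.< r → r ℕ.≤ n′ → ζ ^ r * a ≈ a → a ≈ 0#

  module _ {n′ ζ} (root : IsRegularRoot n′ ζ) where
    open IsRegularRoot root

    ζ⃗ : Vector Carrier n′
    ζ⃗ i = ζ ^ suc (toℕ i)

    private
      n = suc n′

      q p : Series
      q = ∏[1- ζ⃗ t] 𝟙
      p = [1- 1# t] q

      dilate-p : dilate ζ p ≐ p
      dilate-p m = begin
        dilate ζ p m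
          -- `p` is by computation the product over ζ⁰, ..., ζⁿ⁻¹, since ζ⁰ reduces to `1#`. The
          -- dilation raises every exponent by one, and ζⁿ = 1 closes the cycle.
          ≈⟨ dilate-∏ ζ (λ (i : Fin n) → ζ ^ toℕ i) 𝟙 m ⟨
        (∏[1- (λ (i : Fin n) → ζ ^ suc (toℕ i)) t] dilate ζ 𝟙) m
          ≈⟨ ∏-cong (λ (i : Fin n) → ζ ^ suc (toℕ i)) (dilate-𝟙 ζ) m ⟩
        (∏[1- (λ (i : Fin n) → ζ ^ suc (toℕ i)) t] 𝟙) m
          ≈⟨ ∏-last n′ (λ i → ζ ^ suc i) 𝟙 m ⟩
        [1- ζ ^ n t] q m
          ≈⟨ [1-t^]-congˡ 1 q ζⁿ≈1 m ⟩
        p m ∎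

      p-inner : ∀ {r} → 0 ℕ.< r → r ℕ.≤ n′ → p r ≈ 0#
      p-inner {r} 0<r r≤n′ = ζʳa≈a⇒a≈0 0<r r≤n′ (dilate-p r)

      -- From p = (1 - t)q each inner coefficient of p is a difference of neighbouring coefficients
      -- of q, and it vanishes. So q is 1 + t + ⋯ + tⁿ⁻¹.
      q-inner : ∀ {r} → r ℕ.≤ n′ → q r ≈ 1#
      q-inner {zero}  r≤n′ = ∏-constant ζ⃗ 𝟙
      q-inner {suc r} r≤n′ = begin
        q (suc r)                    ≈⟨ solve 2 (λ u v → u := u :- con (+ 1) :* v :+ v) refl (q (suc r)) (q r) ⟩
        p (suc r) + q r              ≈⟨ +-cong (p-inner (ℕ.s≤s ℕ.z≤n) r≤n′) (q-inner (ℕ.<⇒≤ r≤n′)) ⟩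
        0# + 1#                      ≈⟨ +-identityˡ 1# ⟩
        1#                           ∎

      -- Past its degree q contributes nothing, and only -tq is left. With b = 1 this gives the
      -- leading coefficient of p, with b = 0 the vanishing beyond it.
      p-suc : ∀ {r b} → n′ ℕ.≤ r → q r ≈ b → p (suc r) ≈ - b
      p-suc {r} {b} n′≤r q≈b = begin
        q (suc r) - 1# * q r   ≈⟨ +-cong (∏-degree ζ⃗ (ℕ.s≤s n′≤r)) (-‿cong (*-congˡ q≈b)) ⟩
        0# - 1# * b            ≈⟨ solve 1 (λ b → con (+ 0) :- con (+ 1) :* b := :- b) refl b ⟩
        - b                    ∎

    ∏[1-ζⁱt] : [1- 1# t] (∏[1- ζ⃗ t] 𝟙) ≐ [1- 1# t^ suc n′ ] 𝟙
    ∏[1-ζⁱt] zero = begin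
      p 0            ≈⟨ [1-t]-constant 1# q ⟩
      q 0            ≈⟨ q-inner ℕ.z≤n ⟩
      1#             ≈⟨ solve 0 (con (+ 1) := con (+ 1) :- con (+ 1) :* con (+ 0)) refl ⟩
      1# - 1# * 0#   ∎
    ∏[1-ζⁱt] (suc r) with ℕ.<-cmp r n′
    ... | tri< r<n′ _ _ = begin
      p (suc r)                       ≈⟨ p-inner (ℕ.s≤s ℕ.z≤n) r<n′ ⟩
      0#                              ≈⟨ solve 0 (con (+ 0) := con (+ 0) :- con (+ 1) :* con (+ 0)) refl ⟩
      0# - 1# * 0#                    ≈⟨ +-congˡ (-‿cong (*-congˡ (shift-< n′ 𝟙 r<n′))) ⟨
      0# - 1# * shift n′ 𝟙 r          ∎
    ... | tri≈ _ ≡.refl _ = begin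
      p n                             ≈⟨ p-suc ℕ.≤-refl (q-inner ℕ.≤-refl) ⟩
      - 1#                            ≈⟨ solve 0 (:- con (+ 1) := con (+ 0) :- con (+ 1) :* con (+ 1)) refl ⟩
      0# - 1# * 1#                    ≈⟨ +-congˡ (-‿cong (*-congˡ (trans (shift-≥ n′ 𝟙 ℕ.≤-refl)
                                           (reflexive (≡.cong 𝟙 (ℕ.n∸n≡0 n′)))))) ⟨
      0# - 1# * shift n′ 𝟙 n′         ∎
    ... | tri> _ _ n′<r = begin
      p (suc r)                       ≈⟨ p-suc (ℕ.<⇒≤ n′<r) (∏-degree ζ⃗ n′<r) ⟩
      - 0#                            ≈⟨ solve 0 (:- con (+ 0) := con (+ 0) :- con (+ 1) :* con (+ 0)) refl ⟩
      0# - 1# * 0#                    ≈⟨ +-congˡ (-‿cong (*-congˡ shift≈0)) ⟨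
      0# - 1# * shift n′ 𝟙 r          ∎
      where
      𝟙-positive : ∀ {j} → 0 ℕ.< j → 𝟙 j ≈ 0#
      𝟙-positive {suc j} _ = refl
      shift≈0 : shift n′ 𝟙 r ≈ 0#
      shift≈0 = trans (shift-≥ n′ 𝟙 (ℕ.<⇒≤ n′<r)) (𝟙-positive (ℕ.m<n⇒0<n∸m n′<r))

    -- At `𝟙` this is the factorisation of 1 - tⁿ with xt substituted for t, which is valid for x =
    -- 0 too. Convolution with f extends it to every series.
    ∏[1-xζⁱt] : ∀ x f →
      [1- x t] (∏[1- (λ i → x * ζ⃗ i) t] f) ≐ [1- x ^ suc n′ t^ suc n′ ] f
    ∏[1-xζⁱt] x f m = begin
      [1- x t] (∏[1- xζ t] f) m             ≈⟨ [1-t^]-cong x 1 (conv-∏ xζ f) m ⟨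
      [1- x t] (conv 1 f (∏[1- xζ t] 𝟙)) m  ≈⟨ conv-[1-t^]ʳ-1 1 x f (∏[1- xζ t] 𝟙) m ⟨
      conv 1 f ([1- x t] (∏[1- xζ t] 𝟙)) m  ≈⟨ conv-cong 1 (λ _ → refl) factors m ⟩
      conv 1 f ([1- x ^ n t^ n ] 𝟙) m       ≈⟨ conv-[1-t^]ʳ-1 n (x ^ n) f 𝟙 m ⟩
      [1- x ^ n t^ n ] (conv 1 f 𝟙) m       ≈⟨ [1-t^]-cong (x ^ n) n (conv-𝟙ʳ 1 f) m ⟩
      [1- x ^ n t^ n ] f m                  ∎
      where
      xζ : Vector Carrier n′
      xζ i = x * ζ⃗ i

      factors : [1- x t] (∏[1- xζ t] 𝟙) ≐ [1- x ^ n t^ n ] 𝟙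
      factors m = begin
        [1- x t] (∏[1- xζ t] 𝟙) m
          ≈⟨ [1-t^]-cong x 1 (∏-cong xζ (dilate-𝟙 x)) m ⟨
        [1- x t] (∏[1- xζ t] dilate x 𝟙) m
          ≈⟨ [1-t^]-cong x 1 (dilate-∏ x ζ⃗ 𝟙) m ⟩
        [1- x t] (dilate x q) m
          ≈⟨ [1-t^]-congˡ 1 (dilate x q) (trans (*-identityʳ _) (*-identityʳ x)) m ⟨
        [1- x ^ 1 * 1# t] (dilate x q) m
          ≈⟨ dilate-[1-t^] x 1# 1 q m ⟩
        dilate x p m
          ≈⟨ *-congˡ (∏[1-ζⁱt] m) ⟩
        dilate x ([1- 1# t^ n ] 𝟙) m
          ≈⟨ dilate-[1-t^] x 1# n 𝟙 m ⟨
        [1- x ^ n * 1# t^ n ] (dilate x 𝟙) m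
          ≈⟨ [1-t^]-cong (x ^ n * 1#) n (dilate-𝟙 x) m ⟩
        [1- x ^ n * 1# t^ n ] 𝟙 m
          ≈⟨ [1-t^]-congˡ n 𝟙 (*-identityʳ _) m ⟩
        [1- x ^ n t^ n ] 𝟙 m ∎

    open SymmetricPolynomials rawRing using (_⊗_; _^ᵛ_)

    private
      ⊗-∏ : ∀ {k} (ξ : Vector Carrier (suc k)) f m →
        (∏[1- ξ ⊗ ζ⃗ t] f) m ≈ (∏[1- (λ i → head ξ * ζ⃗ i) t] ∏[1- tail ξ ⊗ ζ⃗ t] f) m
      ⊗-∏ ξ f m = reflexive (≡.cong (λ h → h m) (foldr-concat [1-_t] f (λ j i → ξ j * ζ⃗ i)))

      ⊗-∏⁻¹ : ∀ {k} (ξ : Vector Carrier (suc k)) f m →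
        (∏[1- ξ ⊗ ζ⃗ t]⁻¹ f) m ≈ (∏[1- (λ i → head ξ * ζ⃗ i) t]⁻¹ ∏[1- tail ξ ⊗ ζ⃗ t]⁻¹ f) m
      ⊗-∏⁻¹ ξ f m = reflexive (≡.cong (λ h → h m) (foldr-concat [1-_t]⁻¹ f (λ j i → ξ j * ζ⃗ i)))

    -- Induction on k, with both sides multiplied by 1 - xⁿtⁿ. On the left this cancels the inverses
    -- 1/(1 - xζⁱt) and leaves 1 - xt, which joins the first argument of `conv`; on the right it
    -- cancels the inverse that x contributes to the second argument.
    ∏⁻¹-⊗ : ∀ {k} (ξ : Vector Carrier k) →
      ∏[1- ξ ⊗ ζ⃗ t]⁻¹ 𝟙 ≐ conv n (∏[1- ξ t] 𝟙) (∏[1- ξ ^ᵛ n t]⁻¹ 𝟙)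
    ∏⁻¹-⊗ {zero}  ξ m = sym (conv-𝟙ʳ n 𝟙 m)
    ∏⁻¹-⊗ {suc k} ξ = [1-t^]-injective (x ^ n) n′ λ m → begin
      [1- x ^ n t^ n ] (∏[1- ξ ⊗ ζ⃗ t]⁻¹ 𝟙) m
        ≈⟨ [1-t^]-cong (x ^ n) n (⊗-∏⁻¹ ξ 𝟙) m ⟩
      [1- x ^ n t^ n ] (∏[1- xζ t]⁻¹ big′) m
        ≈⟨ ∏[1-xζⁱt] x (∏[1- xζ t]⁻¹ big′) m ⟨
      [1- x t] (∏[1- xζ t] ∏[1- xζ t]⁻¹ big′) m
        ≈⟨ [1-t^]-cong x 1 (∏-inverse xζ big′) m ⟩
      [1- x t] big′ m
        ≈⟨ [1-t^]-cong x 1 (∏⁻¹-⊗ (tail ξ)) m ⟩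
      [1- x t] (conv n e′ h′) m
        ≈⟨ conv-[1-t]ˡ n′ x e′ h′ m ⟨
      conv n ([1- x t] e′) h′ m
        ≈⟨ conv-cong n (λ _ → refl) ([1-t]-inverse (x ^ n) h′) m ⟨
      conv n ([1- x t] e′) ([1- x ^ n t] ([1- x ^ n t]⁻¹ h′)) m
        ≈⟨ conv-[1-t]ʳ n′ (x ^ n) ([1- x t] e′) ([1- x ^ n t]⁻¹ h′) m ⟩
      [1- x ^ n t^ n ] (conv n ([1- x t] e′) ([1- x ^ n t]⁻¹ h′)) m ∎
      where
      x = head ξ
      xζ : Vector Carrier n′
      xζ i = x * ζ⃗ i
      big′ = ∏[1- tail ξ ⊗ ζ⃗ t]⁻¹ 𝟙
      e′ = ∏[1- tail ξ t] 𝟙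
      h′ = ∏[1- tail ξ ^ᵛ n t]⁻¹ 𝟙

    -- The dual induction: multiplying by 1 - xt completes the block of x to 1 - xⁿtⁿ, which enters
    -- the second argument of `conv` as the factor 1 - xⁿt.
    ∏-⊗ : ∀ {k} (ξ : Vector Carrier k) →
      ∏[1- ξ ⊗ ζ⃗ t] 𝟙 ≐ conv n (∏[1- ξ t]⁻¹ 𝟙) (∏[1- ξ ^ᵛ n t] 𝟙)
    ∏-⊗ {zero}  ξ m = sym (conv-𝟙ʳ n 𝟙 m)
    ∏-⊗ {suc k} ξ = [1-t^]-injective x 0 λ m → begin
      [1- x t] (∏[1- ξ ⊗ ζ⃗ t] 𝟙) m
        ≈⟨ [1-t^]-cong x 1 (⊗-∏ ξ 𝟙) m ⟩
      [1- x t] (∏[1- xζ t] big′) m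
        ≈⟨ ∏[1-xζⁱt] x big′ m ⟩
      [1- x ^ n t^ n ] big′ m
        ≈⟨ [1-t^]-cong (x ^ n) n (∏-⊗ (tail ξ)) m ⟩
      [1- x ^ n t^ n ] (conv n h′ e′) m
        ≈⟨ conv-[1-t]ʳ n′ (x ^ n) h′ e′ m ⟨
      conv n h′ ([1- x ^ n t] e′) m
        ≈⟨ conv-cong n ([1-t]-inverse x h′) (λ _ → refl) m ⟨
      conv n ([1- x t] ([1- x t]⁻¹ h′)) ([1- x ^ n t] e′) m
        ≈⟨ conv-[1-t]ˡ n′ x ([1- x t]⁻¹ h′) ([1- x ^ n t] e′) m ⟩
      [1- x t] (conv n ([1- x t]⁻¹ h′) ([1- x ^ n t] e′)) m ∎
      where
      x = head ξ
      xζ : Vector Carrier n′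
      xζ i = x * ζ⃗ i
      big′ = ∏[1- tail ξ ⊗ ζ⃗ t] 𝟙
      h′ = ∏[1- tail ξ t]⁻¹ 𝟙
      e′ = ∏[1- tail ξ ^ᵛ n t] 𝟙

-- Recursions for sums of monomials over monotone index tuples.

module LinkedSums {c ℓ} (R : CommutativeRing c ℓ) where
  open CommutativeRing R hiding (zero)
  open SymmetricPolynomials rawRing using (tuples; sumOver)
  open SemiringSum semiring using (sum; sum-cong-≋)
  open SetoidReasoning setoid

  sumOver-filter-++ : ∀ {r m p} {P : Unary.Pred (Vec (Fin r) m) p} (P? : Unary.Decidable P) z xs ys →
    sumOver z (List.filter P? (xs List.++ ys))
      ≈ sumOver z (List.filter P? xs) + sumOver z (List.filter P? ys)
  sumOver-filter-++ P? z []       ys = sym (+-identityˡ _)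
  sumOver-filter-++ P? z (x ∷ xs) ys with does (P? x)
  ... | false = sumOver-filter-++ P? z xs ys
  ... | true  = trans (+-congˡ (sumOver-filter-++ P? z xs ys)) (sym (+-assoc _ _ _))

  sumOver-filter-product : ∀ {r m p} {P : Unary.Pred (Vec (Fin r) (suc m)) p}
    (P? : Unary.Decidable P) z {s} (js : Vector (Fin r) s) (ts : List (Vec (Fin r) m)) →
    sumOver z (List.filter P? (List.cartesianProductWith Vec._∷_ (List.tabulate js) ts))
      ≈ sum (λ i → sumOver z (List.filter P? (List.map (js i Vec.∷_) ts)))
  sumOver-filter-product P? z {zero}  js ts = refl
  sumOver-filter-product P? z {suc s} js ts = trans
    (sumOver-filter-++ P? z (List.map (head js Vec.∷_) ts) _)
    (+-congˡ (sumOver-filter-product P? z (tail js) ts))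

  -- `filter` only inspects the Boolean part of a decision. The Boolean b tells whether j is
  -- admissible in front at all; if not, the whole block drops out.
  sumOver-filter-cons : ∀ {r m p q} {P : Unary.Pred (Vec (Fin r) (suc m)) p}
    {Q : Unary.Pred (Vec (Fin r) m) q} (P? : Unary.Decidable P) (Q? : Unary.Decidable Q) z j b →
    (∀ js → does (P? (j Vec.∷ js)) ≡ b ∧ does (Q? js)) → ∀ ts →
    sumOver z (List.filter P? (List.map (j Vec.∷_) ts))
      ≈ (if b then z j * sumOver z (List.filter Q? ts) else 0#)
  sumOver-filter-cons P? Q? z j false P≡Q []       = refl
  sumOver-filter-cons P? Q? z j true  P≡Q []       = sym (zeroʳ _)
  sumOver-filter-cons P? Q? z j false P≡Q (t ∷ ts) rewrite P≡Q t =
    sumOver-filter-cons P? Q? z j false P≡Q ts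
  sumOver-filter-cons P? Q? z j true  P≡Q (t ∷ ts) rewrite P≡Q t with does (Q? t)
  ... | false = sumOver-filter-cons P? Q? z j true P≡Q ts
  ... | true  = trans (+-congˡ (sumOver-filter-cons P? Q? z j true P≡Q ts)) (sym (distribˡ _ _ _))

  if-cong : ∀ {b b′} x → b ≡ b′ → (if b then x else 0#) ≈ (if b′ then x else 0#)
  if-cong x ≡.refl = refl

  module _ {p} {_~_ : ∀ {r} → Rel (Fin r) p} (_~?_ : ∀ {r} → Decidable (_~_ {r})) where

    linkedSum : ∀ {r} → Vector Carrier r → ℕ → Carrier
    linkedSum {r} z m = sumOver z (List.filter (linked? _~?_) (tuples m r))

    -- The tuples that may follow i; the factor z i is left out. Whether j ∷ js is linked depends on
    -- j, so the recursion on length needs this auxiliary sum.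
    linkedSumAfter : ∀ {r} → Vector Carrier r → Fin r → ℕ → Carrier
    linkedSumAfter {r} z i m = sumOver z (List.filter (λ js → linked? _~?_ (i Vec.∷ js)) (tuples m r))

    linkedSum-suc : ∀ {r} (z : Vector Carrier r) m →
      linkedSum z (suc m) ≈ sum (λ j → z j * linkedSumAfter z j m)
    linkedSum-suc {r} z m = trans
      (sumOver-filter-product (linked? _~?_) z id (tuples m r))
      (sum-cong-≋ (λ j → sumOver-filter-cons (linked? _~?_) (λ js → linked? _~?_ (j Vec.∷ js))
        z j true (λ _ → ≡.refl) (tuples m r)))

    linkedSumAfter-suc : ∀ {r} (z : Vector Carrier r) i m →
      linkedSumAfter z i (suc m) ≈ sum (λ j → if does (i ~? j) then z j * linkedSumAfter z j m else 0#)
    linkedSumAfter-suc {r} z i m = trans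
      (sumOver-filter-product (λ js → linked? _~?_ (i Vec.∷ js)) z id (tuples m r))
      (sum-cong-≋ (λ j → sumOver-filter-cons _ (λ js → linked? _~?_ (j Vec.∷ js))
        z j (does (i ~? j)) (λ _ → ≡.refl) (tuples m r)))

    module _
      (suc~?suc  : ∀ {r} (i j : Fin r) → does (Fin.suc i ~? Fin.suc j) ≡ does (i ~? j))
      (suc~?zero : ∀ {r} (i : Fin r) → does (Fin.suc i ~? Fin.zero) ≡ false)
      where

      -- Once a successor index has occurred, index 0 is excluded for good, so all later variables
      -- belong to the tail.
      linkedSumAfter-tail : ∀ {r} (z : Vector Carrier (suc r)) i m →
        linkedSumAfter z (Fin.suc i) m ≈ linkedSumAfter (tail z) i m
      linkedSumAfter-tail z i zero    = refl
      linkedSumAfter-tail z i (suc m) = begin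
        linkedSumAfter z (Fin.suc i) (suc m)
          ≈⟨ linkedSumAfter-suc z (Fin.suc i) m ⟩
        (if does (Fin.suc i ~? Fin.zero) then head z * linkedSumAfter z Fin.zero m else 0#) + sum (tail terms)
          ≈⟨ +-congʳ (if-cong _ (suc~?zero i)) ⟩
        0# + sum (tail terms)
          ≈⟨ +-identityˡ _ ⟩
        sum (λ j → if does (Fin.suc i ~? Fin.suc j) then tail z j * linkedSumAfter z (Fin.suc j) m else 0#)
          ≈⟨ sum-cong-≋ step ⟩
        sum (λ j → if does (i ~? j) then tail z j * linkedSumAfter (tail z) j m else 0#)
          ≈⟨ linkedSumAfter-suc (tail z) i m ⟨
        linkedSumAfter (tail z) i (suc m) ∎
        where
        terms = λ j → if does (Fin.suc i ~? j) then z j * linkedSumAfter z j m else 0#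

        step : ∀ j → (if does (Fin.suc i ~? Fin.suc j) then tail z j * linkedSumAfter z (Fin.suc j) m else 0#)
                       ≈ (if does (i ~? j) then tail z j * linkedSumAfter (tail z) j m else 0#)
        step j rewrite suc~?suc i j with does (i ~? j)
        ... | true  = *-congˡ (linkedSumAfter-tail z j m)
        ... | false = refl

      sum-linkedSumAfter-tail : ∀ {r} (z : Vector Carrier (suc r)) m →
        sum (λ j → tail z j * linkedSumAfter z (Fin.suc j) m) ≈ linkedSum (tail z) (suc m)
      sum-linkedSumAfter-tail z m = trans
        (sum-cong-≋ (λ j → *-congˡ (linkedSumAfter-tail z j m)))
        (sym (linkedSum-suc (tail z) m))

      linkedSum-split : ∀ {r} (z : Vector Carrier (suc r)) m →
        linkedSum z (suc m) ≈ head z * linkedSumAfter z Fin.zero m + linkedSum (tail z) (suc m)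
      linkedSum-split z m = trans (linkedSum-suc z m) (+-congˡ (sum-linkedSumAfter-tail z m))

      -- b decides whether index 0 may repeat: false for strict tuples, true for weak ones.
      linkedSumAfter-zero : ∀ {r} (z : Vector Carrier (suc r)) m b →
        does (Fin.zero {r} ~? Fin.zero) ≡ b → (∀ j → does (Fin.zero {r} ~? Fin.suc j) ≡ true) →
        linkedSumAfter z Fin.zero (suc m)
          ≈ (if b then head z * linkedSumAfter z Fin.zero m else 0#) + linkedSum (tail z) (suc m)
      linkedSumAfter-zero z m b 0~?0 0~?suc = trans (linkedSumAfter-suc z Fin.zero m) (+-cong
        (if-cong _ 0~?0)
        (trans (sum-cong-≋ (λ j → if-cong (tail z j * linkedSumAfter z (Fin.suc j) m) (0~?suc j)))
               (sum-linkedSumAfter-tail z m)))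

-- Elementary and complete symmetric polynomials as coefficients.

module SymmetricSeries {c ℓ} (R : CommutativeRing c ℓ) where
  open CommutativeRing R hiding (zero)
  open SymmetricPolynomials rawRing using (ℰ; ℋ; _^_)
  open IntegerSolver R using (solve; _:=_; _:+_; _:*_; _:-_; :-_; con)
  open LinkedSums R
  open PowerSeries R
  open SetoidReasoning setoid

  -- A strictly increasing tuple either starts at 0 and continues in the tail, or avoids 0.
  ℰ-suc : ∀ {r} (z : Vector Carrier (suc r)) m →
    ℰ (suc m) z ≈ head z * ℰ m (tail z) + ℰ (suc m) (tail z)
  ℰ-suc {r} z m = trans (linkedSum-split Fin._<?_ (λ _ _ → ≡.refl) (λ _ → ≡.refl) z m)
                        (+-congʳ (*-congˡ (after m)))
    where
    after : ∀ m → linkedSumAfter Fin._<?_ z Fin.zero m ≈ ℰ m (tail z)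
    after zero    = refl
    after (suc m) = trans
      (linkedSumAfter-zero Fin._<?_ (λ _ _ → ≡.refl) (λ _ → ≡.refl) z m false ≡.refl (λ _ → ≡.refl))
      (+-identityˡ _)

  -- Index 0 may repeat, so after a leading 0 any weakly increasing tuple is allowed; hence all of z
  -- in the first term.
  ℋ-suc : ∀ {r} (z : Vector Carrier (suc r)) m →
    ℋ (suc m) z ≈ head z * ℋ m z + ℋ (suc m) (tail z)
  ℋ-suc {r} z m = trans (linkedSum-split Fin._≤?_ suc≤?suc (λ _ → ≡.refl) z m)
                        (+-congʳ (*-congˡ (after m)))
    where
    -- The weak comparison computes by cases on its first argument, so i = 0 is split off.
    suc≤?suc : ∀ {r} (i j : Fin r) → does (Fin.suc i Fin.≤? Fin.suc j) ≡ does (i Fin.≤? j)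
    suc≤?suc Fin.zero    j = ≡.refl
    suc≤?suc (Fin.suc i) j = ≡.refl

    after : ∀ m → linkedSumAfter Fin._≤?_ z Fin.zero m ≈ ℋ m z
    after zero    = refl
    after (suc m) = trans
      (linkedSumAfter-zero Fin._≤?_ suc≤?suc (λ _ → ≡.refl) z m true ≡.refl (λ _ → ≡.refl))
      (sym (linkedSum-split Fin._≤?_ suc≤?suc (λ _ → ≡.refl) z m))

  ∏-ℰ : ∀ {r} (z : Vector Carrier r) m → (∏[1- z t] 𝟙) m ≈ (- 1#) ^ m * ℰ m z
  ∏-ℰ {zero}  z zero    = solve 0 (con (+ 1) := con (+ 1) :* (con (+ 1) :+ con (+ 0))) refl
  ∏-ℰ {zero}  z (suc m) = sym (zeroʳ _)
  ∏-ℰ {suc r} z zero    = trans ([1-t]-constant (head z) (∏[1- tail z t] 𝟙)) (∏-ℰ (tail z) zero)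
  ∏-ℰ {suc r} z (suc m) = begin
    (∏[1- tail z t] 𝟙) (suc m) - head z * (∏[1- tail z t] 𝟙) m
      ≈⟨ +-cong (∏-ℰ (tail z) (suc m)) (-‿cong (*-congˡ (∏-ℰ (tail z) m))) ⟩
    - 1# * s * ℰ (suc m) (tail z) - head z * (s * ℰ m (tail z))
      ≈⟨ solve 4 (λ s x u v → :- con (+ 1) :* s :* u :- x :* (s :* v) := :- con (+ 1) :* s :* (x :* v :+ u))
           refl s (head z) (ℰ (suc m) (tail z)) (ℰ m (tail z)) ⟩
    - 1# * s * (head z * ℰ m (tail z) + ℰ (suc m) (tail z))
      ≈⟨ *-congˡ (ℰ-suc z m) ⟨
    - 1# * s * ℰ (suc m) z ∎
    where s = (- 1#) ^ m

  ∏⁻¹-ℋ : ∀ {r} (z : Vector Carrier r) m → (∏[1- z t]⁻¹ 𝟙) m ≈ ℋ m z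
  ∏⁻¹-ℋ {zero}  z zero    = sym (+-identityʳ 1#)
  ∏⁻¹-ℋ {zero}  z (suc m) = refl
  ∏⁻¹-ℋ {suc r} z zero    = ∏⁻¹-ℋ (tail z) zero
  ∏⁻¹-ℋ {suc r} z (suc m) = begin
    (∏[1- tail z t]⁻¹ 𝟙) (suc m) + head z * (∏[1- z t]⁻¹ 𝟙) m
      ≈⟨ +-cong (∏⁻¹-ℋ (tail z) (suc m)) (*-congˡ (∏⁻¹-ℋ z m)) ⟩
    ℋ (suc m) (tail z) + head z * ℋ m z
      ≈⟨ +-comm _ _ ⟩
    head z * ℋ m z + ℋ (suc m) (tail z)
      ≈⟨ ℋ-suc z m ⟨
    ℋ (suc m) z ∎

-- The identities over a ring with a regular root of unity.

module RootsOfUnityIdentities {c ℓ} (R : CommutativeRing c ℓ) where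
  open CommutativeRing R hiding (zero)
  open SymmetricPolynomials rawRing
  open IntegerSolver R using (solve; _:=_; _:*_; :-_; con)
  open InitialSums R
  open SemiringExp semiring using (^-homo-*)
  open PowerSeries R
  open SymmetricSeries R
  open RootsOfUnity R
  open SetoidReasoning setoid

  -- The inequalities tn ≤ m < (t + 1)n express t = [m/n] in a form that passes from (t + 1, m) to
  -- (t, m - n).
  partialConv-sum : ∀ n t N {m} f g → t ℕ.≤ N → t ℕ.* n ℕ.≤ m → m ℕ.< suc t ℕ.* n →
    partialConv n N f g m ≈ ∑[0⋯ t ] (λ j → g j * f (m ℕ.∸ j ℕ.* n))
  partialConv-sum n zero zero    f g _ _ m<n = sym (+-identityʳ _)
  partialConv-sum n zero (suc N) f g _ _ m<n =
    +-congˡ (shift-< n _ (≡.subst (_ ℕ.<_) (ℕ.+-identityʳ n) m<n))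
  partialConv-sum n (suc t) (suc N) {m} f g t≤N n+tn≤m m<2n+tn = +-congˡ (begin
    shift n (partialConv n N f (λ j → g (suc j))) m
      ≈⟨ shift-≥ n _ (ℕ.m+n≤o⇒m≤o n n+tn≤m) ⟩
    partialConv n N f (λ j → g (suc j)) (m ℕ.∸ n)
      ≈⟨ partialConv-sum n t N f (λ j → g (suc j)) (ℕ.s≤s⁻¹ t≤N)
           (≡.subst (ℕ._≤ m ℕ.∸ n) (ℕ.m+n∸m≡n n (t ℕ.* n)) (ℕ.∸-monoˡ-≤ n n+tn≤m))
           (≡.subst (m ℕ.∸ n ℕ.<_) (ℕ.m+n∸m≡n n _) (ℕ.∸-monoˡ-< m<2n+tn (ℕ.m+n≤o⇒m≤o n n+tn≤m))) ⟩
    ∑[0⋯ t ] (λ j → g (suc j) * f (m ℕ.∸ n ℕ.∸ j ℕ.* n))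
      ≈⟨ ∑-cong-≤ t (λ {j} _ → *-congˡ {g (suc j)} (reflexive (≡.cong f (ℕ.∸-+-assoc m n (j ℕ.* n))))) ⟩
    ∑[0⋯ t ] (λ j → g (suc j) * f (m ℕ.∸ suc j ℕ.* n)) ∎)

  conv-sum : ∀ n′ m f g → let n = suc n′ in
    conv n f g m ≈ ∑[0⋯ m ℕ./ n ] (λ j → g j * f (m ℕ.∸ j ℕ.* n))
  conv-sum n′ m f g = partialConv-sum n (m ℕ./ n) m f g (ℕ.m/n≤m m n) (ℕ.m/n*n≤m m n)
    (≡.subst (ℕ._< suc (m ℕ./ n) ℕ.* n) (≡.sym (ℕ.m≡m%n+[m/n]*n m n)) (ℕ.+-monoˡ-< _ (ℕ.m%n<n m n)))
    where n = suc n′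

  -1^m²≈1 : ∀ m → (- 1#) ^ m * (- 1#) ^ m ≈ 1#
  -1^m²≈1 zero    = *-identityʳ 1#
  -1^m²≈1 (suc m) = trans
    (solve 1 (λ s → (:- con (+ 1) :* s) :* (:- con (+ 1) :* s) := s :* s) refl ((- 1#) ^ m))
    (-1^m²≈1 m)

  -1^m-1^j : ∀ {m j} → j ℕ.≤ m → (- 1#) ^ m * (- 1#) ^ j ≈ (- 1#) ^ (m ℕ.∸ j)
  -1^m-1^j {m} {j} j≤m = begin
    (- 1#) ^ m * s                            ≡⟨ ≡.cong (λ i → (- 1#) ^ i * s) (ℕ.m∸n+n≡m j≤m) ⟨
    (- 1#) ^ (m ℕ.∸ j ℕ.+ j) * s              ≈⟨ *-congʳ (^-homo-* (- 1#) (m ℕ.∸ j) j) ⟩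
    (- 1#) ^ (m ℕ.∸ j) * s * s                ≈⟨ *-assoc _ _ _ ⟩
    (- 1#) ^ (m ℕ.∸ j) * (s * s)              ≈⟨ *-congˡ (-1^m²≈1 j) ⟩
    (- 1#) ^ (m ℕ.∸ j) * 1#                   ≈⟨ *-identityʳ _ ⟩
    (- 1#) ^ (m ℕ.∸ j)                        ∎
    where s = (- 1#) ^ j

  ℰ-∏ : ∀ {r} (z : Vector Carrier r) m → ℰ m z ≈ (- 1#) ^ m * (∏[1- z t] 𝟙) m
  ℰ-∏ z m = begin
    ℰ m z                                     ≈⟨ *-identityˡ _ ⟨
    1# * ℰ m z                                ≈⟨ *-congʳ (-1^m²≈1 m) ⟨
    (- 1#) ^ m * (- 1#) ^ m * ℰ m z           ≈⟨ *-assoc _ _ _ ⟩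
    (- 1#) ^ m * ((- 1#) ^ m * ℰ m z)         ≈⟨ *-congˡ (∏-ℰ z m) ⟨
    (- 1#) ^ m * (∏[1- z t] 𝟙) m              ∎

  ℰ-degree : ∀ {r} (z : Vector Carrier r) {m} → r ℕ.< m → ℰ m z ≈ 0#
  ℰ-degree z {m} r<m = trans (ℰ-∏ z m) (trans (*-congˡ (∏-degree z r<m)) (zeroʳ _))

  module _ {n′ ζ} (root : IsRegularRoot n′ ζ) {k} (ξ : Vector Carrier k) (m : ℕ) where
    private
      n = suc n′
      ξ⊗ζ⃗ = ξ ⊗ ζ⃗ root

      term : ℕ → Carrier
      term j = (- 1#) ^ (m ℕ.∸ j) * ℋ (m ℕ.∸ j ℕ.* n) ξ * ℰ j (ξ ^ᵛ n)

    ℋ-⊗ : ℋ m (ξ ⊗ ζ⃗ root) ≈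
      ∑[0⋯ m ℕ./ suc n′ ] λ j → (- 1#) ^ (m ℕ.∸ j ℕ.* suc n′) * ℰ (m ℕ.∸ j ℕ.* suc n′) ξ * ℋ j (ξ ^ᵛ suc n′)
    ℋ-⊗ = begin
      ℋ m ξ⊗ζ⃗
        ≈⟨ ∏⁻¹-ℋ ξ⊗ζ⃗ m ⟨
      (∏[1- ξ⊗ζ⃗ t]⁻¹ 𝟙) m
        ≈⟨ ∏⁻¹-⊗ root ξ m ⟩
      conv n (∏[1- ξ t] 𝟙) (∏[1- ξ ^ᵛ n t]⁻¹ 𝟙) m
        ≈⟨ conv-sum n′ m _ _ ⟩
      ∑[0⋯ m ℕ./ n ] (λ j → (∏[1- ξ ^ᵛ n t]⁻¹ 𝟙) j * (∏[1- ξ t] 𝟙) (m ℕ.∸ j ℕ.* n))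
        ≈⟨ ∑-cong-≤ (m ℕ./ n) (λ {j} _ → trans (*-comm _ _) (*-cong (∏-ℰ ξ (m ℕ.∸ j ℕ.* n)) (∏⁻¹-ℋ (ξ ^ᵛ n) j))) ⟩
      ∑[0⋯ m ℕ./ n ] (λ j → (- 1#) ^ (m ℕ.∸ j ℕ.* n) * ℰ (m ℕ.∸ j ℕ.* n) ξ * ℋ j (ξ ^ᵛ n)) ∎

    ℰ-⊗ : ℰ m (ξ ⊗ ζ⃗ root) ≈
      ∑[0⋯ m ℕ./ suc n′ ] λ j → (- 1#) ^ (m ℕ.∸ j) * ℋ (m ℕ.∸ j ℕ.* suc n′) ξ * ℰ j (ξ ^ᵛ suc n′)
    ℰ-⊗ = begin
      ℰ m ξ⊗ζ⃗
        ≈⟨ ℰ-∏ ξ⊗ζ⃗ m ⟩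
      (- 1#) ^ m * (∏[1- ξ⊗ζ⃗ t] 𝟙) m
        ≈⟨ *-congˡ (∏-⊗ root ξ m) ⟩
      (- 1#) ^ m * conv n (∏[1- ξ t]⁻¹ 𝟙) (∏[1- ξ ^ᵛ n t] 𝟙) m
        ≈⟨ *-congˡ (conv-sum n′ m _ _) ⟩
      (- 1#) ^ m * ∑[0⋯ m ℕ./ n ] (λ j → (∏[1- ξ ^ᵛ n t] 𝟙) j * (∏[1- ξ t]⁻¹ 𝟙) (m ℕ.∸ j ℕ.* n))
        ≈⟨ *-∑ (m ℕ./ n) ((- 1#) ^ m) (λ i → (∏[1- ξ ^ᵛ n t] 𝟙) i * (∏[1- ξ t]⁻¹ 𝟙) (m ℕ.∸ i ℕ.* n)) ⟩
      ∑[0⋯ m ℕ./ n ] (λ j → (- 1#) ^ m * ((∏[1- ξ ^ᵛ n t] 𝟙) j * (∏[1- ξ t]⁻¹ 𝟙) (m ℕ.∸ j ℕ.* n)))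
        ≈⟨ ∑-cong-≤ (m ℕ./ n) step ⟩
      ∑[0⋯ m ℕ./ n ] term ∎
      where
      step : ∀ {j} → j ℕ.≤ m ℕ./ n →
        (- 1#) ^ m * ((∏[1- ξ ^ᵛ n t] 𝟙) j * (∏[1- ξ t]⁻¹ 𝟙) (m ℕ.∸ j ℕ.* n)) ≈ term j
      step {j} j≤m/n = begin
        (- 1#) ^ m * ((∏[1- ξ ^ᵛ n t] 𝟙) j * (∏[1- ξ t]⁻¹ 𝟙) (m ℕ.∸ j ℕ.* n))
          ≈⟨ *-congˡ (*-cong (∏-ℰ (ξ ^ᵛ n) j) (∏⁻¹-ℋ ξ (m ℕ.∸ j ℕ.* n))) ⟩
        (- 1#) ^ m * ((- 1#) ^ j * ℰ j (ξ ^ᵛ n) * ℋ (m ℕ.∸ j ℕ.* n) ξ)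
          ≈⟨ solve 4 (λ s s′ e h → s :* (s′ :* e :* h) := s :* s′ :* h :* e) refl
               ((- 1#) ^ m) ((- 1#) ^ j) (ℰ j (ξ ^ᵛ n)) (ℋ (m ℕ.∸ j ℕ.* n) ξ) ⟩
        (- 1#) ^ m * (- 1#) ^ j * ℋ (m ℕ.∸ j ℕ.* n) ξ * ℰ j (ξ ^ᵛ n)
          ≈⟨ *-congʳ (*-congʳ (-1^m-1^j (ℕ.≤-trans j≤m/n (ℕ.m/n≤m m n)))) ⟩
        term j ∎

    -- ξ ⊗ ζ⃗ has k(n - 1) entries, fewer than m, so its ℰ m is 0. The sum stops at M/n instead of
    -- m/n; when nk ≤ m this is k, and the further terms contain ℰ j of k variables with j > k.
    ℰ-⊗-vanishing : m ℕ.> n′ ℕ.* k →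
      ∑[0⋯ (m ℕ.⊓ (suc n′ ℕ.* k)) ℕ./ suc n′ ]
        (λ j → (- 1#) ^ (m ℕ.∸ j) * ℋ (m ℕ.∸ j ℕ.* suc n′) ξ * ℰ j (ξ ^ᵛ suc n′)) ≈ 0#
    ℰ-⊗-vanishing m>n′k = begin
      ∑[0⋯ (m ℕ.⊓ (n ℕ.* k)) ℕ./ n ] term   ≈⟨ truncate ⟩
      ∑[0⋯ m ℕ./ n ] term                   ≈⟨ ℰ-⊗ ⟨
      ℰ m ξ⊗ζ⃗                               ≈⟨ ℰ-degree ξ⊗ζ⃗ (≡.subst (ℕ._< m) (ℕ.*-comm n′ k) m>n′k) ⟩
      0#                                    ∎
      where
      truncate : ∑[0⋯ (m ℕ.⊓ (n ℕ.* k)) ℕ./ n ] term ≈ ∑[0⋯ m ℕ./ n ] term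
      truncate with ℕ.≤-total m (n ℕ.* k)
      ... | inj₁ m≤nk = reflexive (≡.cong (λ M → ∑[0⋯ M ℕ./ n ] term) (ℕ.m≤n⇒m⊓n≡m m≤nk))
      ... | inj₂ nk≤m = ∑-extend term (ℕ./-monoˡ-≤ n (ℕ.m⊓n≤m m (n ℕ.* k)))
        (λ {j} t<j → trans (*-congˡ (ℰ-degree (ξ ^ᵛ n) (≡.subst (ℕ._< j) M/n≡k t<j))) (zeroʳ _))
        where
        M/n≡k : (m ℕ.⊓ (n ℕ.* k)) ℕ./ n ≡ k
        M/n≡k = ≡.trans (≡.cong (ℕ._/ n) (ℕ.m≥n⇒m⊓n≡n nk≤m))
          (≡.trans (≡.cong (ℕ._/ n) (ℕ.*-comm n k)) (ℕ.m*n/n≡m k n))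

-- Constructive ordered fields: inequalities and bounds.

module OrderedFieldProperties {c ℓ₁ ℓ₂ ℓ₃} (F : OrderedField c ℓ₁ ℓ₂ ℓ₃) where
  open OrderedField F hiding (zero)
  open CommutativeRing commutativeRing using (semiring)
  open IntegerSolver commutativeRing using (solve; _:=_; _:+_; _:*_; _:-_; :-_; con)
  open HeytingProperties heytingCommutativeRing using (invertibleʳ⇒#; x-0≈x; #-congʳ; x#0y#0→xy#0)
  open SemiringMult semiring using (×-homo-+; ×1-homo-*)
  open SemiringExp semiring using (_^_)
  open SetoidReasoning setoid

  -- Unlike _<_, the order _≤_ is a negation, so that inequalities may be
  -- proved by contradiction.
  infix 4 _≤_
  _≤_ : Carrier → Carrier → Set ℓ₃
  x ≤ y = ¬ (y < x)

  -- Cotransitivity of apartness, where transitivity repairs the case of the wrong sign. It replaces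
  -- trichotomy.
  <-cotrans : ∀ {x y} → x < y → ∀ z → x < z ⊎ z < y
  <-cotrans {x} {y} x<y z with #-cotrans (Equivalence.from (#⇔<⊎> x y) (inj₁ x<y)) z
  ... | inj₁ x#z = [ inj₁ , (λ z<x → inj₂ (<-trans z<x x<y)) ]′ (Equivalence.to (#⇔<⊎> x z) x#z)
  ... | inj₂ z#y = [ inj₂ , (λ y<z → inj₁ (<-trans x<y y<z)) ]′ (Equivalence.to (#⇔<⊎> z y) z#y)

  #0⇒<0⊎>0 : ∀ {x} → x # 0# → x < 0# ⊎ 0# < x
  #0⇒<0⊎>0 = Equivalence.to (#⇔<⊎> _ _)

  <-asym : ∀ {x y} → x < y → ¬ (y < x)
  <-asym x<y y<x = <-irrefl refl (<-trans x<y y<x)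

  <⇒≤ : ∀ {x y} → x < y → x ≤ y
  <⇒≤ = <-asym

  <-cong : ∀ {x x′ y y′} → x ≈ x′ → y ≈ y′ → x < y → x′ < y′
  <-cong x≈x′ y≈y′ x<y = <-respˡ-≈ x≈x′ (<-respʳ-≈ y≈y′ x<y)

  ≤-reflexive : ∀ {x y} → x ≈ y → x ≤ y
  ≤-reflexive x≈y y<x = <-irrefl (sym x≈y) y<x

  ≤-refl : ∀ {x} → x ≤ x
  ≤-refl = ≤-reflexive refl

  ≤-cong : ∀ {x x′ y y′} → x ≈ x′ → y ≈ y′ → x ≤ y → x′ ≤ y′
  ≤-cong x≈x′ y≈y′ x≤y y′<x′ = x≤y (<-cong (sym y≈y′) (sym x≈x′) y′<x′)

  ≤-<-trans : ∀ {x y z} → x ≤ y → y < z → x < z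
  ≤-<-trans x≤y y<z = [ (λ y<x → ⊥-elim (x≤y y<x)) , id ]′ (<-cotrans y<z _)

  ≤-trans : ∀ {x y z} → x ≤ y → y ≤ z → x ≤ z
  ≤-trans x≤y y≤z z<x = [ y≤z , x≤y ]′ (<-cotrans z<x _)

  ¬#⇒≈ : ∀ {x y} → ¬ (x # y) → x ≈ y
  ¬#⇒≈ = proj₁ (tight _ _)

  ≤-antisym : ∀ {x y} → x ≤ y → y ≤ x → x ≈ y
  ≤-antisym x≤y y≤x = ¬#⇒≈ (λ x#y → [ y≤x , x≤y ]′ (Equivalence.to (#⇔<⊎> _ _) x#y))

  +-mono-< : ∀ {x y u v} → x < y → u < v → x + u < y + v
  +-mono-< x<y u<v =
    <-trans (+-monoʳ-< _ u<v) (<-cong (+-comm _ _) (+-comm _ _) (+-monoʳ-< _ x<y))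

  +-monoʳ-≤ : ∀ x {y z} → y ≤ z → x + y ≤ x + z
  +-monoʳ-≤ x {y} {z} y≤z x+z<x+y = y≤z (<-cong (cancel z) (cancel y) (+-monoʳ-< (- x) x+z<x+y))
    where
    cancel : ∀ u → - x + (x + u) ≈ u
    cancel u = solve 2 (λ x u → :- x :+ (x :+ u) := u) refl x u

  +-mono-≤ : ∀ {x y u v} → x ≤ y → u ≤ v → x + u ≤ y + v
  +-mono-≤ {x} {y} {u} {v} x≤y u≤v =
    ≤-trans (+-monoʳ-≤ x u≤v) (≤-cong (+-comm v x) (+-comm v y) (+-monoʳ-≤ v x≤y))

  neg-mono-≤ : ∀ {x y} → x ≤ y → - y ≤ - x
  neg-mono-≤ {x} {y} x≤y = ≤-cong
    (solve 2 (λ x y → :- x :- y :+ x := :- y) refl x y)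
    (solve 2 (λ x y → :- x :- y :+ y := :- x) refl x y)
    (+-monoʳ-≤ (- x - y) x≤y)

  x≤y⇒0≤y-x : ∀ {x y} → x ≤ y → 0# ≤ y - x
  x≤y⇒0≤y-x {x} {y} x≤y = ≤-cong (-‿inverseˡ x) (+-comm _ _) (+-monoʳ-≤ (- x) x≤y)

  0≤y-x⇒x≤y : ∀ {x y} → 0# ≤ y - x → x ≤ y
  0≤y-x⇒x≤y {x} {y} 0≤y-x = ≤-cong (+-identityʳ x)
    (solve 2 (λ x y → x :+ (y :- x) := y) refl x y) (+-monoʳ-≤ x 0≤y-x)

  x<y⇒0<y-x : ∀ {x y} → x < y → 0# < y - x
  x<y⇒0<y-x {x} {y} x<y = <-cong (-‿inverseˡ x) (+-comm _ _) (+-monoʳ-< (- x) x<y)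

  0<y-x⇒x<y : ∀ {x y} → 0# < y - x → x < y
  0<y-x⇒x<y {x} {y} 0<y-x = <-cong (+-identityʳ x)
    (solve 2 (λ x y → x :+ (y :- x) := y) refl x y) (+-monoʳ-< x 0<y-x)

  x<0⇒0<-x : ∀ {x} → x < 0# → 0# < - x
  x<0⇒0<-x {x} x<0 = <-respʳ-≈ (+-identityˡ _) (x<y⇒0<y-x x<0)

  xy≈1⇒x#0 : ∀ {x y} → x * y ≈ 1# → x # 0#
  xy≈1⇒x#0 {x} {y} xy≈1 = invertibleʳ⇒# (y , trans (*-congʳ (x-0≈x x)) xy≈1)

  -- If w inverts xy, then yw inverts x.
  xy#0⇒x#0 : ∀ {x y} → x * y # 0# → x # 0#
  xy#0⇒x#0 {x} {y} xy#0 with #⇒invertible xy#0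
  ... | w , _ , xyw≈1 = xy≈1⇒x#0 {y = y * w}
    (trans (sym (*-assoc x y w)) (trans (*-congʳ (sym (x-0≈x (x * y)))) xyw≈1))

  xy#0⇒y#0 : ∀ {x y} → x * y # 0# → y # 0#
  xy#0⇒y#0 {x} {y} xy#0 = xy#0⇒x#0 (#-congʳ (*-comm x y) xy#0)

  <0⇒#0 : ∀ {x} → x < 0# → x # 0#
  <0⇒#0 x<0 = Equivalence.from (#⇔<⊎> _ _) (inj₁ x<0)

  >0⇒#0 : ∀ {x} → 0# < x → x # 0#
  >0⇒#0 0<x = Equivalence.from (#⇔<⊎> _ _) (inj₂ 0<x)

  -- The assumption xy < 0 makes both factors apart from 0, so that each nonnegative factor becomes
  -- positive.
  *-nonneg : ∀ {x y} → 0# ≤ x → 0# ≤ y → 0# ≤ x * y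
  *-nonneg {x} {y} 0≤x 0≤y xy<0 =
    <-asym xy<0 (*-pos (positive 0≤x (xy#0⇒x#0 xy#0)) (positive 0≤y (xy#0⇒y#0 xy#0)))
    where
    xy#0 = <0⇒#0 xy<0
    positive : ∀ {z} → 0# ≤ z → z # 0# → 0# < z
    positive 0≤z z#0 = [ (λ z<0 → ⊥-elim (0≤z z<0)) , id ]′ (#0⇒<0⊎>0 z#0)

  square-nonneg : ∀ x → 0# ≤ x * x
  square-nonneg x xx<0 =
    [ (λ x<0 → <-asym xx<0 (<-respʳ-≈ (solve 1 (λ x → (:- x) :* (:- x) := x :* x) refl x)
                             (*-pos (x<0⇒0<-x x<0) (x<0⇒0<-x x<0))))
    , (λ 0<x → <-asym xx<0 (*-pos 0<x 0<x))
    ]′ (#0⇒<0⊎>0 (xy#0⇒x#0 (<0⇒#0 xx<0)))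

  -- x is only known to differ from 0. The goal is an equality, hence stable under double negation,
  -- and while it is being refuted x may be taken apart from 0.
  xy≈0⇒y≈0 : ∀ {x y} → ¬ (x ≈ 0#) → x * y ≈ 0# → y ≈ 0#
  xy≈0⇒y≈0 {x} {y} x≉0 xy≈0 = ¬#⇒≈ λ y#0 →
    x≉0 (¬#⇒≈ λ x#0 → #-irrefl xy≈0 (x#0y#0→xy#0 x#0 y#0))

  xx≈0⇒x≈0 : ∀ {x} → x * x ≈ 0# → x ≈ 0#
  xx≈0⇒x≈0 xx≈0 = ¬#⇒≈ λ x#0 → #-irrefl xx≈0 (x#0y#0→xy#0 x#0 x#0)

  xx+yy≈0⇒x≈0 : ∀ {x y} → x * x + y * y ≈ 0# → x ≈ 0#
  xx+yy≈0⇒x≈0 {x} {y} eq = xx≈0⇒x≈0 (≤-antisym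
    (≤-cong (+-identityʳ _) eq (+-monoʳ-≤ (x * x) (square-nonneg y)))
    (square-nonneg x))

  *-monoˡ-≤ : ∀ {x y z} → 0# ≤ x → y ≤ z → x * y ≤ x * z
  *-monoˡ-≤ {x} {y} {z} 0≤x y≤z = 0≤y-x⇒x≤y (≤-cong refl
    (solve 3 (λ x y z → x :* (z :- y) := x :* z :- x :* y) refl x y z)
    (*-nonneg 0≤x (x≤y⇒0≤y-x y≤z)))

  *-monoʳ-≤ : ∀ {x y z} → 0# ≤ x → y ≤ z → y * x ≤ z * x
  *-monoʳ-≤ 0≤x y≤z = ≤-cong (*-comm _ _) (*-comm _ _) (*-monoˡ-≤ 0≤x y≤z)

  fromℕ-+ : ∀ m n → fromℕ (m ℕ.+ n) ≈ fromℕ m + fromℕ n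
  fromℕ-+ = ×-homo-+ 1#

  fromℕ-* : ∀ m n → fromℕ (m ℕ.* n) ≈ fromℕ m * fromℕ n
  fromℕ-* = ×1-homo-*

  fromℕ-1 : fromℕ 1 ≈ 1#
  fromℕ-1 = +-identityʳ 1#

  fromℕ-nonneg : ∀ n → 0# ≤ fromℕ n
  fromℕ-nonneg zero    = ≤-refl
  fromℕ-nonneg (suc n) = <⇒≤ (0<fromℕ n)

  fromℕ-mono-≤ : ∀ {m n} → m ℕ.≤ n → fromℕ m ≤ fromℕ n
  fromℕ-mono-≤ {m} {n} m≤n = ≤-cong (+-identityʳ _)
    (trans (sym (fromℕ-+ m (n ℕ.∸ m))) (reflexive (≡.cong fromℕ (ℕ.m+[n∸m]≡n m≤n))))
    (+-monoʳ-≤ (fromℕ m) (fromℕ-nonneg (n ℕ.∸ m)))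

  fromℕ-recip : ∀ n .{{_ : ℕ.NonZero n}} → fromℕ n * recip n ≈ 1#
  fromℕ-recip (suc n) = trans (*-congʳ (sym (x-0≈x _))) (proj₂ (proj₂ (#⇒invertible (fromℕ#0 n))))

  inverse-pos : ∀ {x y} → 0# < x → x * y ≈ 1# → 0# < y
  inverse-pos {x} {y} 0<x xy≈1 =
    [ (λ y<0 → ⊥-elim (<-asym 0<1 (<-cong (+-identityʳ 1#) negative
                                    (+-monoʳ-< 1# (*-pos 0<x (x<0⇒0<-x y<0))))))
    , id ]′ (#0⇒<0⊎>0 (xy≈1⇒x#0 {y = x} (trans (*-comm y x) xy≈1)))
    where
    negative : 1# + x * - y ≈ 0#
    negative = begin
      1# + x * - y   ≈⟨ solve 2 (λ x y → con (+ 1) :+ x :* :- y := con (+ 1) :- x :* y) refl x y ⟩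
      1# - x * y     ≈⟨ +-congˡ (-‿cong xy≈1) ⟩
      1# - 1#        ≈⟨ -‿inverseʳ 1# ⟩
      0#             ∎

  recip-pos : ∀ n .{{_ : ℕ.NonZero n}} → 0# < recip n
  recip-pos (suc n) = inverse-pos (0<fromℕ n) (fromℕ-recip (suc n))

  -- Seals the inverse behind `½`, so that type checking does not unfold it.
  abstract
    ½ : Carrier
    ½ = recip 2

    2½≈1 : fromℕ 2 * ½ ≈ 1#
    2½≈1 = fromℕ-recip 2

    ½-pos : 0# < ½
    ½-pos = recip-pos 2

  ½+½≈1 : ½ + ½ ≈ 1#
  ½+½≈1 = trans
    -- `fromℕ 2` unfolds to `1# + (1# + 0#)`, which the right-hand side spells out.
    (solve 1 (λ h → h :+ h := (con (+ 1) :+ (con (+ 1) :+ con (+ 0))) :* h) refl ½)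
    2½≈1

  halves : ∀ x → x * ½ + x * ½ ≈ x
  halves x = trans (sym (distribˡ x ½ ½)) (trans (*-congˡ ½+½≈1) (*-identityʳ x))

  half-pos : ∀ {x} → 0# < x → 0# < x * ½
  half-pos 0<x = *-pos 0<x ½-pos

  half<  : ∀ {x} → 0# < x → x * ½ < x
  half< {x} 0<x = <-cong (+-identityʳ _) (halves x) (+-monoʳ-< (x * ½) (half-pos 0<x))

  ½^-pos : ∀ n → 0# < ½ ^ n
  ½^-pos zero    = 0<1
  ½^-pos (suc n) = *-pos ½-pos (½^-pos n)

  ½^-double : ∀ n → ½ ^ suc n + ½ ^ suc n ≈ ½ ^ n
  ½^-double n = trans (sym (distribʳ (½ ^ n) ½ ½)) (trans (*-congʳ ½+½≈1) (*-identityˡ _))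

  ½^≤1 : ∀ n → ½ ^ n ≤ 1#
  ½^≤1 zero    = ≤-refl
  ½^≤1 (suc n) = ≤-trans
    (≤-cong (+-identityʳ _) (½^-double n) (+-monoʳ-≤ (½ ^ suc n) (<⇒≤ (½^-pos (suc n)))))
    (½^≤1 n)

  2^-½^ : ∀ n → fromℕ (2 ℕ.^ n) * ½ ^ n ≈ 1#
  2^-½^ zero    = trans (*-congʳ fromℕ-1) (*-identityʳ 1#)
  2^-½^ (suc n) = begin
    fromℕ (2 ℕ.* 2 ℕ.^ n) * (½ * ½ ^ n)        ≈⟨ *-congʳ (fromℕ-* 2 (2 ℕ.^ n)) ⟩
    fromℕ 2 * fromℕ (2 ℕ.^ n) * (½ * ½ ^ n)    ≈⟨ solve 4 (λ a b c d → a :* b :* (c :* d) := a :* c :* (b :* d)) refl _ _ _ _ ⟩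
    fromℕ 2 * ½ * (fromℕ (2 ℕ.^ n) * ½ ^ n)    ≈⟨ *-cong 2½≈1 (2^-½^ n) ⟩
    1# * 1#                                    ≈⟨ *-identityʳ 1# ⟩
    1#                                         ∎

  infix 4 ∣_∣≤_
  -- A pair of inequalities instead of an absolute value, which spares a decision on the sign of x.
  ∣_∣≤_ : Carrier → Carrier → Set ℓ₃
  ∣ x ∣≤ b = (- b ≤ x) × (x ≤ b)

  ∣∣≤-cong : ∀ {x x′ b} → x ≈ x′ → ∣ x ∣≤ b → ∣ x′ ∣≤ b
  ∣∣≤-cong x≈x′ (-b≤x , x≤b) = ≤-cong refl x≈x′ -b≤x , ≤-cong x≈x′ refl x≤b

  ∣∣≤-mono : ∀ {x b b′} → b ≤ b′ → ∣ x ∣≤ b → ∣ x ∣≤ b′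
  ∣∣≤-mono b≤b′ (-b≤x , x≤b) = ≤-trans (neg-mono-≤ b≤b′) -b≤x , ≤-trans x≤b b≤b′

  ∣∣≤-+ : ∀ {x y b b′} → ∣ x ∣≤ b → ∣ y ∣≤ b′ → ∣ x + y ∣≤ b + b′
  ∣∣≤-+ {b = b} {b′} (-b≤x , x≤b) (-b≤y , y≤b) =
    ≤-cong (solve 2 (λ b b′ → :- b :+ :- b′ := :- (b :+ b′)) refl b b′) refl (+-mono-≤ -b≤x -b≤y)
    , +-mono-≤ x≤b y≤b

  ∣∣≤-neg : ∀ {x b} → ∣ x ∣≤ b → ∣ - x ∣≤ b
  ∣∣≤-neg {x} {b} (-b≤x , x≤b) =
    neg-mono-≤ x≤b , ≤-cong refl (solve 1 (λ b → :- (:- b) := b) refl b) (neg-mono-≤ -b≤x)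

  ∣0∣≤ : ∀ {b} → 0# ≤ b → ∣ 0# ∣≤ b
  ∣0∣≤ 0≤b = ≤-cong refl (solve 0 (:- con (+ 0) := con (+ 0)) refl) (neg-mono-≤ 0≤b) , 0≤b

  ∣x∣≤x : ∀ {x} → 0# ≤ x → ∣ x ∣≤ x
  ∣x∣≤x {x} 0≤x = ≤-trans (proj₁ (∣0∣≤ 0≤x)) 0≤x , ≤-refl

  ∣∣≤⇒0≤ : ∀ {x b} → ∣ x ∣≤ b → 0# ≤ b
  ∣∣≤⇒0≤ {x} {b} (-b≤x , x≤b) b<0 =
    ≤-trans -b≤x x≤b (<-trans b<0 (x<0⇒0<-x b<0))

  -- 2(bb′ ± xy) = (b ∓ x)(b′ + y) + (b ± x)(b′ - y), up to the choice of signs.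
  ∣∣≤-* : ∀ {x y b b′} → ∣ x ∣≤ b → ∣ y ∣≤ b′ → ∣ x * y ∣≤ b * b′
  ∣∣≤-* {x} {y} {b} {b′} (-b≤x , x≤b) (-b′≤y , y≤b′) =
    0≤y-x⇒x≤y (halve (≤-cong refl
      (solve 4 (λ x y b c → (b :- x) :* (c :- y) :+ (x :- :- b) :* (y :- :- c)
                         := (x :* y :- :- (b :* c)) :+ (x :* y :- :- (b :* c))) refl x y b b′)
      (nonneg-+ (*-nonneg (x≤y⇒0≤y-x x≤b) (x≤y⇒0≤y-x y≤b′)) (*-nonneg (x≤y⇒0≤y-x -b≤x) (x≤y⇒0≤y-x -b′≤y)))))
    , 0≤y-x⇒x≤y (halve (≤-cong refl
      (solve 4 (λ x y b c → (b :- x) :* (y :- :- c) :+ (x :- :- b) :* (c :- y)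
                         := (b :* c :- x :* y) :+ (b :* c :- x :* y)) refl x y b b′)
      (nonneg-+ (*-nonneg (x≤y⇒0≤y-x x≤b) (x≤y⇒0≤y-x -b′≤y)) (*-nonneg (x≤y⇒0≤y-x -b≤x) (x≤y⇒0≤y-x y≤b′)))))
    where
    nonneg-+ : ∀ {u v} → 0# ≤ u → 0# ≤ v → 0# ≤ u + v
    nonneg-+ 0≤u 0≤v = ≤-cong (+-identityʳ 0#) refl (+-mono-≤ 0≤u 0≤v)
    halve : ∀ {u} → 0# ≤ u + u → 0# ≤ u
    halve 0≤u+u u<0 = 0≤u+u (<-respʳ-≈ (+-identityʳ 0#) (+-mono-< u<0 u<0))

-- Null sequences and limits of real sequences.

module RealSequences {c ℓ₁ ℓ₂ ℓ₃} (ℝ : RealNumbers c ℓ₁ ℓ₂ ℓ₃) where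
  open RealNumbers ℝ hiding (zero)
  open OrderedFieldProperties orderedField
  open CommutativeRing commutativeRing using (semiring)
  open IntegerSolver commutativeRing using (solve; _:=_; _:+_; _:*_; _:-_; :-_; con)
  open SemiringExp semiring using (_^_)
  open SetoidReasoning setoid

  -- Limits are treated as differences that tend to 0, with weak bounds that add and multiply
  -- easily. The return to the strict bounds of `ConvergesTo` costs a factor ½.
  Null : (ℕ → Carrier) → Set (c ⊔ ℓ₃)
  Null a = ∀ ε → 0# < ε → ∃[ N ] (∀ p → N ℕ.≤ p → ∣ a p ∣≤ ε)

  bound : ∀ x → ∃[ Q ] ∣ x ∣≤ fromℕ Q
  bound x with archimedean x | archimedean (- x)
  ... | Q₁ , x<Q₁ | Q₂ , -x<Q₂ = Q₁ ℕ.+ Q₂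
    , ≤-cong refl (solve 1 (λ x → :- (:- x) := x) refl x)
        (neg-mono-≤ (≤-trans (<⇒≤ -x<Q₂) (fromℕ-mono-≤ (ℕ.m≤n+m Q₂ Q₁))))
    , ≤-trans (<⇒≤ x<Q₁) (fromℕ-mono-≤ (ℕ.m≤m+n Q₁ Q₂))

  null-cong : ∀ {a b} → (∀ p → a p ≈ b p) → Null a → Null b
  null-cong a≈b null ε 0<ε =
    let N , below = null ε 0<ε in N , λ p N≤p → ∣∣≤-cong (a≈b p) (below p N≤p)

  null-neg : ∀ {a} → Null a → Null (λ p → - a p)
  null-neg null ε 0<ε =
    let N , below = null ε 0<ε in N , λ p N≤p → ∣∣≤-neg (below p N≤p)

  null-+ : ∀ {a b} → Null a → Null b → Null (λ p → a p + b p)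
  null-+ null-a null-b ε 0<ε =
    let N₁ , below₁ = null-a (ε * ½) (half-pos 0<ε)
        N₂ , below₂ = null-b (ε * ½) (half-pos 0<ε)
    in N₁ ℕ.⊔ N₂ , λ p N≤p →
    ∣∣≤-mono (≤-reflexive (halves ε))
      (∣∣≤-+ (below₁ p (ℕ.m⊔n≤o⇒m≤o N₁ N₂ N≤p)) (below₂ p (ℕ.m⊔n≤o⇒n≤o N₁ N₂ N≤p)))

  null-* : ∀ {a b} → Null a → Null b → Null (λ p → a p * b p)
  null-* null-a null-b ε 0<ε =
    let N₁ , below₁ = null-a 1# 0<1
        N₂ , below₂ = null-b ε 0<ε
    in N₁ ℕ.⊔ N₂ , λ p N≤p →
    ∣∣≤-mono (≤-reflexive (*-identityˡ ε))
      (∣∣≤-* (below₁ p (ℕ.m⊔n≤o⇒m≤o N₁ N₂ N≤p)) (below₂ p (ℕ.m⊔n≤o⇒n≤o N₁ N₂ N≤p)))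

  null-scale : ∀ x {a} → Null a → Null (λ p → x * a p)
  null-scale x null ε 0<ε =
    -- `suc Q`, because the bound `Q` may be 0 and then has no reciprocal.
    let N , below = null (ε * recip (suc Q)) (*-pos 0<ε (recip-pos (suc Q)))
    in N , λ p N≤p → ∣∣≤-mono (≤-reflexive Q*ε/Q≈ε)
      (∣∣≤-* (∣∣≤-mono (fromℕ-mono-≤ (ℕ.n≤1+n Q)) (proj₂ (bound x))) (below p N≤p))
    where
    Q = proj₁ (bound x)

    Q*ε/Q≈ε : fromℕ (suc Q) * (ε * recip (suc Q)) ≈ ε
    Q*ε/Q≈ε = begin
      fromℕ (suc Q) * (ε * recip (suc Q))   ≈⟨ solve 3 (λ q e r → q :* (e :* r) := e :* (q :* r)) refl (fromℕ (suc Q)) ε (recip (suc Q)) ⟩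
      ε * (fromℕ (suc Q) * recip (suc Q))   ≈⟨ *-congˡ (fromℕ-recip (suc Q)) ⟩
      ε * 1#                                ≈⟨ *-identityʳ ε ⟩
      ε                                     ∎

  -- With w = 1/ε and p ≥ M > Cw, the estimate 2ᵖ ≥ p gives C ≤ 2ᵖε, that is, C2⁻ᵖ ≤ ε.
  null-½^ : ∀ C {a} → (∀ p → ∣ a p ∣≤ fromℕ C * ½ ^ p) → Null a
  null-½^ C {a} ∣a∣≤ ε 0<ε = M , λ p M≤p → ∣∣≤-mono
    (≤-trans (*-monoʳ-≤ (<⇒≤ (½^-pos p)) (C≤ M≤p)) (≤-reflexive (cancel p))) (∣a∣≤ p)
    where
    w : Carrier
    w = proj₁ (#⇒invertible (>0⇒#0 0<ε))

    εw≈1 : (ε - 0#) * w ≈ 1#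
    εw≈1 = proj₂ (proj₂ (#⇒invertible (>0⇒#0 0<ε)))

    M : ℕ
    M = proj₁ (archimedean (fromℕ C * w))

    Cw<M : fromℕ C * w < fromℕ M
    Cw<M = proj₂ (archimedean (fromℕ C * w))

    n≤2^n : ∀ n → n ℕ.≤ 2 ℕ.^ n
    n≤2^n zero    = ℕ.z≤n
    n≤2^n (suc n) = ℕ.+-mono-≤ (ℕ.m^n>0 2 n) (ℕ.≤-trans (n≤2^n n) (ℕ.m≤m+n (2 ℕ.^ n) 0))

    C≤ : ∀ {p} → M ℕ.≤ p → fromℕ C ≤ fromℕ (2 ℕ.^ p) * ε
    C≤ {p} M≤p = ≤-cong Cwε≈C refl
      (*-monoʳ-≤ (<⇒≤ 0<ε) (≤-trans (<⇒≤ Cw<M) (fromℕ-mono-≤ (ℕ.≤-trans M≤p (n≤2^n p)))))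
      where
      Cwε≈C : fromℕ C * w * ε ≈ fromℕ C
      Cwε≈C = begin
        fromℕ C * w * ε          ≈⟨ solve 3 (λ a w e → a :* w :* e := a :* ((e :- con (+ 0)) :* w)) refl (fromℕ C) w ε ⟩
        fromℕ C * ((ε - 0#) * w) ≈⟨ *-congˡ εw≈1 ⟩
        fromℕ C * 1#             ≈⟨ *-identityʳ _ ⟩
        fromℕ C                  ∎

    cancel : ∀ p → fromℕ (2 ℕ.^ p) * ε * ½ ^ p ≈ ε
    cancel p = begin
      fromℕ (2 ℕ.^ p) * ε * ½ ^ p     ≈⟨ solve 3 (λ a e h → a :* e :* h := e :* (a :* h)) refl (fromℕ (2 ℕ.^ p)) ε (½ ^ p) ⟩
      ε * (fromℕ (2 ℕ.^ p) * ½ ^ p)   ≈⟨ *-congˡ (2^-½^ p) ⟩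
      ε * 1#                          ≈⟨ *-identityʳ ε ⟩
      ε                               ∎

  within⇒∣∣≤ : ∀ {ε x y} → Within ε x y → ∣ x - y ∣≤ ε
  within⇒∣∣≤ {ε} {x} {y} (x<y+ε , y<x+ε) =
    0≤y-x⇒x≤y (≤-cong refl (solve 3 (λ x y e → (x :+ e) :- y := (x :- y) :- (:- e)) refl x y ε)
      (x≤y⇒0≤y-x (<⇒≤ y<x+ε)))
    , 0≤y-x⇒x≤y (≤-cong refl (solve 3 (λ x y e → (y :+ e) :- x := e :- (x :- y)) refl x y ε)
      (x≤y⇒0≤y-x (<⇒≤ x<y+ε)))

  ∣∣≤⇒within : ∀ {ε x y b} → b < ε → ∣ x - y ∣≤ b → Within ε x y
  ∣∣≤⇒within {ε} {x} {y} {b} b<ε (-b≤x-y , x-y≤b) =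
    <-cong (solve 2 (λ x y → y :+ (x :- y) := x) refl x y) refl
      (+-monoʳ-< y (≤-<-trans x-y≤b b<ε))
    , <-cong (solve 2 (λ x y → x :+ (:- (x :- y)) := y) refl x y) refl
      (+-monoʳ-< x (≤-<-trans (≤-cong refl (solve 1 (λ b → :- (:- b) := b) refl b) (neg-mono-≤ -b≤x-y)) b<ε))

  converges⇒null : ∀ {a x} → ConvergesTo a x → Null (λ p → a p - x)
  converges⇒null conv ε 0<ε =
    let N , within = conv ε 0<ε in N , λ p N≤p → within⇒∣∣≤ (within p N≤p)

  null⇒converges : ∀ {a x} → Null (λ p → a p - x) → ConvergesTo a x
  null⇒converges null ε 0<ε =
    let N , below = null (ε * ½) (half-pos 0<ε) in N , λ p N≤p → ∣∣≤⇒within (half< 0<ε) (below p N≤p)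

  convergesTo-cong : ∀ {a b x y} → (∀ p → a p ≈ b p) → x ≈ y → ConvergesTo a x → ConvergesTo b y
  convergesTo-cong a≈b x≈y conv =
    null⇒converges (null-cong (λ p → +-cong (a≈b p) (-‿cong x≈y)) (converges⇒null conv))

  convergesTo-const : ∀ x → ConvergesTo (λ _ → x) x
  convergesTo-const x = null⇒converges (λ ε 0<ε →
    0 , λ _ _ → ∣∣≤-cong (sym (-‿inverseʳ x)) (∣0∣≤ (<⇒≤ 0<ε)))

  null-const⇒≈0 : ∀ {x} → Null (λ _ → x) → x ≈ 0#
  null-const⇒≈0 {x} null = ¬#⇒≈ λ x#0 →
    [ (λ x<0 → absurd (x<0⇒0<-x x<0) (null-neg null)) , (λ 0<x → absurd 0<x null) ]′ (#0⇒<0⊎>0 x#0)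
    where
    absurd : ∀ {y} → 0# < y → Null (λ _ → y) → ⊥
    absurd {y} 0<y null =
      let N , below = null (y * ½) (half-pos 0<y) in proj₂ (below N ℕ.≤-refl) (half< 0<y)

  convergesTo-unique : ∀ {a x y} → ConvergesTo a x → ConvergesTo a y → x ≈ y
  convergesTo-unique {a} {x} {y} a→x a→y = begin
    x             ≈⟨ solve 2 (λ x y → x := (x :- y) :+ y) refl x y ⟩
    (x - y) + y   ≈⟨ +-congʳ (null-const⇒≈0 null) ⟩
    0# + y        ≈⟨ +-identityˡ y ⟩
    y             ∎
    where
    null : Null (λ _ → x - y)
    null = null-cong (λ p → solve 3 (λ u x y → (u :- y) :- (u :- x) := x :- y) refl (a p) x y)
      (null-+ (converges⇒null a→y) (null-neg (converges⇒null a→x)))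

  convergesTo-+ : ∀ {a b x y} → ConvergesTo a x → ConvergesTo b y →
    ConvergesTo (λ p → a p + b p) (x + y)
  convergesTo-+ {a} {b} {x} {y} a→x b→y = null⇒converges (null-cong
    (λ p → solve 4 (λ u v x y → (u :- x) :+ (v :- y) := (u :+ v) :- (x :+ y)) refl (a p) (b p) x y)
    (null-+ (converges⇒null a→x) (converges⇒null b→y)))

  convergesTo-neg : ∀ {a x} → ConvergesTo a x → ConvergesTo (λ p → - a p) (- x)
  convergesTo-neg {a} {x} a→x = null⇒converges (null-cong
    (λ p → solve 2 (λ u x → :- (u :- x) := :- u :- :- x) refl (a p) x)
    (null-neg (converges⇒null a→x)))

  -- Expanding uv about the limits x, y leaves a product of two null sequences and two constant
  -- multiples of null sequences.
  convergesTo-* : ∀ {a b x y} → ConvergesTo a x → ConvergesTo b y →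
    ConvergesTo (λ p → a p * b p) (x * y)
  convergesTo-* {a} {b} {x} {y} a→x b→y = null⇒converges (null-cong
    (λ p → solve 4 (λ u v x y → (u :- x) :* (v :- y) :+ (x :* (v :- y) :+ y :* (u :- x)) := u :* v :- x :* y)
             refl (a p) (b p) x y)
    (null-+ (null-* null-a null-b) (null-+ (null-scale x null-b) (null-scale y null-a))))
    where
    null-a = converges⇒null a→x
    null-b = converges⇒null b→y

  cauchy-½^ : ∀ C {a} → (∀ N p → N ℕ.≤ p → ∣ a p - a N ∣≤ fromℕ C * ½ ^ N) → Cauchy a
  cauchy-½^ C {a} tails ε 0<ε = N , λ p q N≤p N≤q → ∣∣≤⇒within (half< 0<ε)
    (∣∣≤-cong (solve 3 (λ u v w → (u :- w) :+ :- (v :- w) := u :- v) refl (a p) (a q) (a N))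
      (∣∣≤-mono (≤-reflexive (halves (ε * ½)))
        (∣∣≤-+ (∣∣≤-mono C½^N≤ (tails N p N≤p)) (∣∣≤-neg (∣∣≤-mono C½^N≤ (tails N q N≤q))))))
    where
    null-C½^ : Null (λ p → fromℕ C * ½ ^ p)
    null-C½^ = null-½^ C (λ p → ∣x∣≤x (*-nonneg (fromℕ-nonneg C) (<⇒≤ (½^-pos p))))

    N : ℕ
    -- Two tails of size ε/4 add up to ε/2, strictly below ε as `Within` demands.
    N = proj₁ (null-C½^ (ε * ½ * ½) (half-pos (half-pos 0<ε)))

    C½^N≤ : fromℕ C * ½ ^ N ≤ ε * ½ * ½
    C½^N≤ = proj₂ (proj₂ (null-C½^ (ε * ½ * ½) (half-pos (half-pos 0<ε))) N ℕ.≤-refl)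

-- The commutative ring of complex numbers.

module ComplexRing {c ℓ₁ ℓ₂ ℓ₃} (ℝ : RealNumbers c ℓ₁ ℓ₂ ℓ₃) where
  private
    module ℝ = RealNumbers ℝ
  open ComplexNumbers ℝ
  open IntegerSolver ℝ.commutativeRing using (solve; _:=_; _:+_; _:*_; _:-_; :-_; con)

  ℂ-commutativeRing : CommutativeRing c ℓ₁
  ℂ-commutativeRing = record
    { Carrier = ℂ ; _≈_ = _≈_ ; _+_ = _+_ ; _*_ = _*_ ; -_ = -_ ; 0# = 0# ; 1# = 1#
    ; isCommutativeRing = record
      { isRing = record
        { +-isAbelianGroup = record
          { isGroup = record
            { isMonoid = record
              { isSemigroup = record
                { isMagma = record
                  { isEquivalence = record
                    { refl  = ℝ.refl , ℝ.refl
                    ; sym   = λ (p , q) → ℝ.sym p , ℝ.sym q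
                    ; trans = λ (p , q) (p′ , q′) → ℝ.trans p p′ , ℝ.trans q q′
                    }
                  ; ∙-cong = λ (p , q) (p′ , q′) → ℝ.+-cong p p′ , ℝ.+-cong q q′
                  }
                ; assoc = λ _ _ _ → ℝ.+-assoc _ _ _ , ℝ.+-assoc _ _ _
                }
              ; identity = (λ _ → ℝ.+-identityˡ _ , ℝ.+-identityˡ _)
                         , (λ _ → ℝ.+-identityʳ _ , ℝ.+-identityʳ _)
              }
            ; inverse = (λ _ → ℝ.-‿inverseˡ _ , ℝ.-‿inverseˡ _)
                      , (λ _ → ℝ.-‿inverseʳ _ , ℝ.-‿inverseʳ _)
            ; ⁻¹-cong = λ (p , q) → ℝ.-‿cong p , ℝ.-‿cong q
            }
          ; comm = λ _ _ → ℝ.+-comm _ _ , ℝ.+-comm _ _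
          }
        ; *-cong = λ (p , q) (p′ , q′) →
            ℝ.+-cong (ℝ.*-cong p p′) (ℝ.-‿cong (ℝ.*-cong q q′)) ,
            ℝ.+-cong (ℝ.*-cong p q′) (ℝ.*-cong q p′)
        ; *-assoc = λ (a +i b) (u +i v) (x +i y) →
            solve 6 (λ a b u v x y → (a :* u :- b :* v) :* x :- (a :* v :+ b :* u) :* y
                                  := a :* (u :* x :- v :* y) :- b :* (u :* y :+ v :* x)) ℝ.refl a b u v x y ,
            solve 6 (λ a b u v x y → (a :* u :- b :* v) :* y :+ (a :* v :+ b :* u) :* x
                                  := a :* (u :* y :+ v :* x) :+ b :* (u :* x :- v :* y)) ℝ.refl a b u v x y
        ; *-identity =
            (λ (x +i y) → solve 2 (λ x y → con (+ 1) :* x :- con (+ 0) :* y := x) ℝ.refl x y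
                        , solve 2 (λ x y → con (+ 1) :* y :+ con (+ 0) :* x := y) ℝ.refl x y) ,
            (λ (x +i y) → solve 2 (λ x y → x :* con (+ 1) :- y :* con (+ 0) := x) ℝ.refl x y
                        , solve 2 (λ x y → x :* con (+ 0) :+ y :* con (+ 1) := y) ℝ.refl x y)
        ; distrib =
            (λ (a +i b) (u +i v) (x +i y) →
              solve 6 (λ a b u v x y → a :* (u :+ x) :- b :* (v :+ y)
                                    := (a :* u :- b :* v) :+ (a :* x :- b :* y)) ℝ.refl a b u v x y ,
              solve 6 (λ a b u v x y → a :* (v :+ y) :+ b :* (u :+ x)
                                    := (a :* v :+ b :* u) :+ (a :* y :+ b :* x)) ℝ.refl a b u v x y) ,
            (λ (a +i b) (u +i v) (x +i y) →
              solve 6 (λ a b u v x y → (u :+ x) :* a :- (v :+ y) :* b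
                                    := (u :* a :- v :* b) :+ (x :* a :- y :* b)) ℝ.refl a b u v x y ,
              solve 6 (λ a b u v x y → (u :+ x) :* b :+ (v :+ y) :* a
                                    := (u :* b :+ v :* a) :+ (x :* b :+ y :* a)) ℝ.refl a b u v x y)
        }
      ; *-comm = λ (a +i b) (x +i y) →
          solve 4 (λ a b x y → a :* x :- b :* y := x :* a :- y :* b) ℝ.refl a b x y ,
          solve 4 (λ a b x y → a :* y :+ b :* x := x :* b :+ y :* a) ℝ.refl a b x y
      }
    }

-- The complex exponential: existence, addition law, conjugation.

module ComplexExponential {c ℓ₁ ℓ₂ ℓ₃} (ℝ : RealNumbers c ℓ₁ ℓ₂ ℓ₃) where
  private
    module ℝ where
      open RealNumbers ℝ public
      open OrderedFieldProperties orderedField public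
      open CommutativeRing commutativeRing public using (semiring)
      open SemiringExp semiring public using (_^_; ^-homo-*)
  open ℝ using (½; fromℕ; recip;
    ∣_∣≤_; ∣∣≤-cong; ∣∣≤-mono; ∣∣≤-+; ∣∣≤-neg; ∣∣≤-*; ∣∣≤⇒0≤; ∣0∣≤; ∣x∣≤x)
  open RealSequences ℝ
  open ComplexNumbers ℝ
  open ComplexRing ℝ
  open CommutativeRing ℂ-commutativeRing 
    using (setoid; semiring; _-_; refl; sym; trans; +-congˡ; +-congʳ; *-congˡ; *-congʳ; -‿inverseʳ;
      zeroˡ; zeroʳ)
  open InitialSums ℂ-commutativeRing
  open SemiringMult semiring using () renaming (_×_ to _⋆_)
  module ℝ-Solver = IntegerSolver ℝ.commutativeRing using (solve; _:=_; _:+_; _:*_; _:-_; :-_; con)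
  module ℂ-Solver = IntegerSolver ℂ-commutativeRing using (solve; _:=_; _:+_; _:*_; _:-_; :-_; con)

  infix 4 ‖_‖≤_
  -- A bound in the maximum norm, which avoids square roots; the price is a factor 2 in each
  -- product.
  ‖_‖≤_ : ℂ → ℝ.Carrier → Set ℓ₃
  ‖ z ‖≤ b = (∣ re z ∣≤ b) × (∣ im z ∣≤ b)

  ‖‖≤-cong : ∀ {z w b} → z ≈ w → ‖ z ‖≤ b → ‖ w ‖≤ b
  ‖‖≤-cong (p , q) (r , s) = ∣∣≤-cong p r , ∣∣≤-cong q s

  ‖‖≤-mono : ∀ {z b b′} → b ℝ.≤ b′ → ‖ z ‖≤ b → ‖ z ‖≤ b′
  ‖‖≤-mono b≤b′ (r , s) = ∣∣≤-mono b≤b′ r , ∣∣≤-mono b≤b′ s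

  ‖‖≤-≈ : ∀ {z b b′} → b ℝ.≈ b′ → ‖ z ‖≤ b → ‖ z ‖≤ b′
  ‖‖≤-≈ b≈b′ = ‖‖≤-mono (ℝ.≤-reflexive b≈b′)

  ‖‖≤-+ : ∀ {z w b b′} → ‖ z ‖≤ b → ‖ w ‖≤ b′ → ‖ z + w ‖≤ b ℝ.+ b′
  ‖‖≤-+ (p , q) (r , s) = ∣∣≤-+ p r , ∣∣≤-+ q s

  ‖‖≤-* : ∀ {z w b b′} → ‖ z ‖≤ b → ‖ w ‖≤ b′ → ‖ z * w ‖≤ b ℝ.* b′ ℝ.+ b ℝ.* b′
  ‖‖≤-* (p , q) (r , s) = ∣∣≤-+ (∣∣≤-* p r) (∣∣≤-neg (∣∣≤-* q s)) , ∣∣≤-+ (∣∣≤-* p s) (∣∣≤-* q r)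

  ‖0‖≤ : ∀ {b} → ℝ.0# ℝ.≤ b → ‖ 0# ‖≤ b
  ‖0‖≤ 0≤b = ∣0∣≤ 0≤b , ∣0∣≤ 0≤b

  ‖1‖≤1 : ‖ 1# ‖≤ fromℕ 1
  ‖1‖≤1 = ∣∣≤-mono (ℝ.≤-reflexive (ℝ.sym ℝ.fromℕ-1)) (∣x∣≤x (ℝ.<⇒≤ ℝ.0<1)) , ∣0∣≤ (ℝ.fromℕ-nonneg 1)

  ofReal-* : ∀ x z → ofReal x * z ≈ (x ℝ.* re z) +i (x ℝ.* im z)
  ofReal-* x (u +i v) =
    solve 3 (λ x u v → x :* u :- con (+ 0) :* v := x :* u) ℝ.refl x u v ,
    solve 3 (λ x u v → x :* v :+ con (+ 0) :* u := x :* v) ℝ.refl x u v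
    where open ℝ-Solver

  ‖ofReal-*‖≤ : ∀ {x z b} → ℝ.0# ℝ.≤ x → ‖ z ‖≤ b → ‖ ofReal x * z ‖≤ x ℝ.* b
  ‖ofReal-*‖≤ {x} {z} 0≤x (p , q) =
    ‖‖≤-cong (sym (ofReal-* x z)) (∣∣≤-* (∣x∣≤x 0≤x) p , ∣∣≤-* (∣x∣≤x 0≤x) q)

  bounded : ∀ z → ∃[ Q ] ‖ z ‖≤ fromℕ (suc Q)
  bounded z =
    let Q₁ , p = bound (re z)
        Q₂ , q = bound (im z)
    in Q₁ ℕ.+ Q₂ , ∣∣≤-mono (ℝ.fromℕ-mono-≤ (ℕ.m≤n⇒m≤1+n (ℕ.m≤m+n Q₁ Q₂))) p
                 , ∣∣≤-mono (ℝ.fromℕ-mono-≤ (ℕ.m≤n⇒m≤1+n (ℕ.m≤n+m Q₂ Q₁))) q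

  ‖^‖≤ : ∀ {z Q} → ‖ z ‖≤ fromℕ Q → ∀ j → ‖ z ^ j ‖≤ fromℕ ((2 ℕ.* Q) ℕ.^ j)
  ‖^‖≤ ‖z‖≤ zero = ‖1‖≤1
  ‖^‖≤ {z} {Q} ‖z‖≤ (suc j) = ‖‖≤-≈ double (‖‖≤-* ‖z‖≤ (‖^‖≤ {Q = Q} ‖z‖≤ j))
    where
    M = (2 ℕ.* Q) ℕ.^ j
    double : fromℕ Q ℝ.* fromℕ M ℝ.+ fromℕ Q ℝ.* fromℕ M ℝ.≈ fromℕ (2 ℕ.* Q ℕ.* M)
    double = ℝ.trans
      (solve 2 (λ q m → q :* m :+ q :* m := ((con (+ 1) :+ (con (+ 1) :+ con (+ 0))) :* q) :* m) ℝ.refl (fromℕ Q) (fromℕ M))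
      (ℝ.trans (ℝ.*-congʳ (ℝ.sym (ℝ.fromℕ-* 2 Q))) (ℝ.sym (ℝ.fromℕ-* (2 ℕ.* Q) M)))
      where open ℝ-Solver

  -- A geometric series: the first term is at most B, and the rest satisfies the hypothesis with B/2
  -- for B.
  ‖∑‖≤ : ∀ N {F B} → (∀ {i} → i ℕ.≤ N → ‖ F i ‖≤ B ℝ.* ½ ℝ.^ i) → ‖ ∑[0⋯ N ] F ‖≤ B ℝ.+ B
  ‖∑‖≤ zero {F} {B} ‖F‖≤ = ‖‖≤-+ ‖F0‖≤ (‖0‖≤ (∣∣≤⇒0≤ (proj₁ ‖F0‖≤)))
    where
    ‖F0‖≤ : ‖ F 0 ‖≤ B
    ‖F0‖≤ = ‖‖≤-≈ (ℝ.*-identityʳ B) (‖F‖≤ ℕ.z≤n)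
  ‖∑‖≤ (suc N) {F} {B} ‖F‖≤ = ‖‖≤-+ (‖‖≤-≈ (ℝ.*-identityʳ B) (‖F‖≤ ℕ.z≤n))
    (‖‖≤-≈ (ℝ.halves B) (‖∑‖≤ N (λ i≤N → ‖‖≤-≈ (ℝ.sym (ℝ.*-assoc B ½ _)) (‖F‖≤ (ℕ.s≤s i≤N)))))

  1/_! : ℕ → ℂ
  1/ j ! = ofReal (recip (j !) {{j ℕ.!≢0}})

  ⋆-ofReal : ∀ n x → n ⋆ ofReal x ≈ ofReal (fromℕ n ℝ.* x)
  ⋆-ofReal zero x = ℝ.sym (ℝ.zeroˡ x) , ℝ.refl
  ⋆-ofReal (suc n) x = trans (+-congˡ (⋆-ofReal n x))
    ( solve 2 (λ x n → x :+ n :* x := (con (+ 1) :+ n) :* x) ℝ.refl x (fromℕ n)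
    , ℝ.+-identityʳ ℝ.0#)
    where open ℝ-Solver

  n!*1/n!≈1 : ∀ n → (n !) ⋆ 1# * 1/ n ! ≈ 1#
  n!*1/n!≈1 n = trans (*-congʳ {1/ n !} (trans (⋆-ofReal (n !) ℝ.1#) (ℝ.*-identityʳ _ , ℝ.refl)))
    (trans (ofReal-* (fromℕ (n !)) (1/ n !))
      (ℝ.fromℕ-recip (n !) {{n ℕ.!≢0}} , ℝ.zeroʳ _))

  open FormalExponential ℂ-commutativeRing using (expTo-+)

  expTerm : ℂ → ℕ → ℂ
  expTerm z j = 1/ j ! * z ^ j

  ℕ-^-distrib-* : ∀ m n j → (m ℕ.* n) ℕ.^ j ≡ m ℕ.^ j ℕ.* n ℕ.^ j
  ℕ-^-distrib-* m n zero    = ≡.refl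
  ℕ-^-distrib-* m n (suc j) = ≡.trans (≡.cong (m ℕ.* n ℕ.*_) (ℕ-^-distrib-* m n j))
    (ℕ.[m*n]*[o*p]≡[m*o]*[n*p] m n (m ℕ.^ j) (n ℕ.^ j))

  -- Up to j = P the constant Pᴾ dominates; from there on each step multiplies the left side by P
  -- and the right side by j + 1 ≥ P.
  power≤factorial : ∀ P .{{_ : ℕ.NonZero P}} j → P ℕ.^ j ℕ.≤ P ℕ.^ P ℕ.* j !
  power≤factorial P zero = ℕ.≤-trans (ℕ.m^n>0 P P) (ℕ.≤-reflexive (≡.sym (ℕ.*-identityʳ (P ℕ.^ P))))
  power≤factorial P (suc j) with ℕ.≤-total (suc j) P
  ... | inj₁ 1+j≤P = ℕ.≤-trans (ℕ.^-monoʳ-≤ P 1+j≤P)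
    (ℕ.m≤m*n (P ℕ.^ P) (suc j !) {{suc j ℕ.!≢0}})
  ... | inj₂ P≤1+j = begin
    P ℕ.* P ℕ.^ j                    ≤⟨ ℕ.*-mono-≤ P≤1+j (power≤factorial P j) ⟩
    suc j ℕ.* (P ℕ.^ P ℕ.* j !)      ≡⟨ ℕ.*-assoc (suc j) (P ℕ.^ P) (j !) ⟨
    suc j ℕ.* P ℕ.^ P ℕ.* j !        ≡⟨ ≡.cong (ℕ._* j !) (ℕ.*-comm (suc j) (P ℕ.^ P)) ⟩
    P ℕ.^ P ℕ.* suc j ℕ.* j !        ≡⟨ ℕ.*-assoc (P ℕ.^ P) (suc j) (j !) ⟩
    P ℕ.^ P ℕ.* (suc j ℕ.* j !)      ∎
    where open ℕ.≤-Reasoning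

  private
    expTerm-≤ : ∀ {z} Q → ‖ z ‖≤ fromℕ (suc Q) →
      ∃[ K ] (∀ j → ‖ expTerm z j ‖≤ fromℕ K ℝ.* (½ ℝ.^ j ℝ.* ½ ℝ.^ j))
    expTerm-≤ {z} Q ‖z‖≤ = P ℕ.^ P , λ j → ‖‖≤-mono (estimate j)
      (‖ofReal-*‖≤ (ℝ.<⇒≤ (ℝ.recip-pos (j !) {{j ℕ.!≢0}})) (‖^‖≤ {Q = suc Q} ‖z‖≤ j))
      where
      -- Mʲ bounds zʲ in the maximum norm. The further factor 4 in P turns Pʲ ≤ Pᴾ j! into Mʲ/j! ≤
      -- Pᴾ 4⁻ʲ.
      M P : ℕ
      M = 2 ℕ.* suc Q
      P = 2 ℕ.* (2 ℕ.* M)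

      estimate : ∀ j → recip (j !) {{j ℕ.!≢0}} ℝ.* fromℕ (M ℕ.^ j)
        ℝ.≤ fromℕ (P ℕ.^ P) ℝ.* (½ ℝ.^ j ℝ.* ½ ℝ.^ j)
      estimate j = ℝ.≤-cong left right
        (ℝ.*-monoʳ-≤ (ℝ.*-nonneg (ℝ.<⇒≤ (ℝ.recip-pos (j !) {{j ℕ.!≢0}})) (ℝ.*-nonneg 0≤h 0≤h))
          (ℝ.fromℕ-mono-≤ (power≤factorial P j)))
        where
        open ℝ-Solver
        open SetoidReasoning (CommutativeRing.setoid ℝ.commutativeRing)
        r = recip (j !) {{j ℕ.!≢0}}
        h = ½ ℝ.^ j
        t = fromℕ (2 ℕ.^ j)
        0≤h : ℝ.0# ℝ.≤ h
        0≤h = ℝ.<⇒≤ (ℝ.½^-pos j)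

        P^j : fromℕ (P ℕ.^ j) ℝ.≈ t ℝ.* (t ℝ.* fromℕ (M ℕ.^ j))
        P^j = begin
          fromℕ (P ℕ.^ j)                                ≡⟨ ≡.cong fromℕ (ℕ-^-distrib-* 2 (2 ℕ.* M) j) ⟩
          fromℕ (2 ℕ.^ j ℕ.* (2 ℕ.* M) ℕ.^ j)            ≈⟨ ℝ.fromℕ-* (2 ℕ.^ j) _ ⟩
          t ℝ.* fromℕ ((2 ℕ.* M) ℕ.^ j)                  ≡⟨ ≡.cong (λ u → t ℝ.* fromℕ u) (ℕ-^-distrib-* 2 M j) ⟩
          t ℝ.* fromℕ (2 ℕ.^ j ℕ.* M ℕ.^ j)              ≈⟨ ℝ.*-congˡ (ℝ.fromℕ-* (2 ℕ.^ j) _) ⟩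
          t ℝ.* (t ℝ.* fromℕ (M ℕ.^ j))                  ∎

        left : fromℕ (P ℕ.^ j) ℝ.* (r ℝ.* (h ℝ.* h)) ℝ.≈ r ℝ.* fromℕ (M ℕ.^ j)
        left = begin
          fromℕ (P ℕ.^ j) ℝ.* (r ℝ.* (h ℝ.* h))
            ≈⟨ ℝ.*-congʳ P^j ⟩
          t ℝ.* (t ℝ.* fromℕ (M ℕ.^ j)) ℝ.* (r ℝ.* (h ℝ.* h))
            ≈⟨ solve 4 (λ t m r h → t :* (t :* m) :* (r :* (h :* h)) := (t :* h) :* (t :* h) :* (r :* m))
                 ℝ.refl t (fromℕ (M ℕ.^ j)) r h ⟩
          (t ℝ.* h) ℝ.* (t ℝ.* h) ℝ.* (r ℝ.* fromℕ (M ℕ.^ j))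
            ≈⟨ ℝ.*-congʳ (ℝ.*-cong (ℝ.2^-½^ j) (ℝ.2^-½^ j)) ⟩
          ℝ.1# ℝ.* ℝ.1# ℝ.* (r ℝ.* fromℕ (M ℕ.^ j))
            ≈⟨ solve 1 (λ u → con (+ 1) :* con (+ 1) :* u := u) ℝ.refl (r ℝ.* fromℕ (M ℕ.^ j)) ⟩
          r ℝ.* fromℕ (M ℕ.^ j) ∎

        right : fromℕ (P ℕ.^ P ℕ.* j !) ℝ.* (r ℝ.* (h ℝ.* h)) ℝ.≈ fromℕ (P ℕ.^ P) ℝ.* (h ℝ.* h)
        right = begin
          fromℕ (P ℕ.^ P ℕ.* j !) ℝ.* (r ℝ.* (h ℝ.* h))
            ≈⟨ ℝ.*-congʳ (ℝ.fromℕ-* (P ℕ.^ P) (j !)) ⟩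
          fromℕ (P ℕ.^ P) ℝ.* fromℕ (j !) ℝ.* (r ℝ.* (h ℝ.* h))
            ≈⟨ solve 4 (λ k f r h → k :* f :* (r :* h) := (f :* r) :* (k :* h)) ℝ.refl
                 (fromℕ (P ℕ.^ P)) (fromℕ (j !)) r (h ℝ.* h) ⟩
          fromℕ (j !) ℝ.* r ℝ.* (fromℕ (P ℕ.^ P) ℝ.* (h ℝ.* h))
            ≈⟨ ℝ.*-congʳ (ℝ.fromℕ-recip (j !) {{j ℕ.!≢0}}) ⟩
          ℝ.1# ℝ.* (fromℕ (P ℕ.^ P) ℝ.* (h ℝ.* h))
            ≈⟨ ℝ.*-identityˡ _ ⟩
          fromℕ (P ℕ.^ P) ℝ.* (h ℝ.* h) ∎

  -- With 4⁻ʲ instead of 2⁻ʲ, a factor 2⁻ⁱ is left over in the error of the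
  -- Cauchy product, which makes the sum over i bounded.
  expTerm-bounded : ∀ z → ∃[ K ] (∀ j → ‖ expTerm z j ‖≤ fromℕ K ℝ.* (½ ℝ.^ j ℝ.* ½ ℝ.^ j))
  expTerm-bounded z = expTerm-≤ (proj₁ (bounded z)) (proj₂ (bounded z))

  expSum-suc : ∀ w p e → (expSum w p - e) + expTerm w (suc p) ≈ expSum w (suc p) - e
  expSum-suc w p e = trans
    (solve 3 (λ s e t → (s :- e) :+ t := (s :+ t) :- e) refl (expSum w p) e (expTerm w (suc p)))
    (+-congʳ (sym (∑-last p (expTerm w))))
    where open ℂ-Solver

  module _ {w} L (term≤ : ∀ j → ‖ expTerm w j ‖≤ fromℕ L ℝ.* (½ ℝ.^ j ℝ.* ½ ℝ.^ j)) where

    expTerm-weak : ∀ j → ‖ expTerm w j ‖≤ fromℕ L ℝ.* ½ ℝ.^ j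
    expTerm-weak j = ‖‖≤-mono (ℝ.*-monoˡ-≤ (ℝ.fromℕ-nonneg L)
      (ℝ.≤-trans (ℝ.*-monoˡ-≤ (ℝ.<⇒≤ (ℝ.½^-pos j)) (ℝ.½^≤1 j)) (ℝ.≤-reflexive (ℝ.*-identityʳ _)))) (term≤ j)

    -- The induction on p needs the sharper bound L(2⁻ᴺ - 2⁻ᵖ), which telescopes because the new
    -- term is at most L times half of 2⁻ᵖ.
    expSum-tail : ∀ {N p} → N ℕ.≤ p → ‖ expSum w p - expSum w N ‖≤ fromℕ L ℝ.* ½ ℝ.^ N
    expSum-tail {N} {p} N≤p =
      ‖‖≤-mono (ℝ.*-monoˡ-≤ (ℝ.fromℕ-nonneg L) (x-y≤x (ℝ.<⇒≤ (ℝ.½^-pos p)))) (go (ℕ.≤⇒≤′ N≤p))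
      where
      open ℝ-Solver
      x-y≤x : ∀ {x y} → ℝ.0# ℝ.≤ y → x ℝ.- y ℝ.≤ x
      x-y≤x {x} {y} 0≤y = ℝ.0≤y-x⇒x≤y (ℝ.≤-cong ℝ.refl (solve 2 (λ x y → y := x :- (x :- y)) ℝ.refl x y) 0≤y)

      go : ∀ {p} → N ℕ.≤′ p → ‖ expSum w p - expSum w N ‖≤ fromℕ L ℝ.* (½ ℝ.^ N ℝ.- ½ ℝ.^ p)
      go (ℕ.≤′-reflexive ≡.refl) = ‖‖≤-≈ (solve 2 (λ l h → con (+ 0) := l :* (h :- h)) ℝ.refl (fromℕ L) (½ ℝ.^ N))
        (‖‖≤-cong (sym (-‿inverseʳ (expSum w N))) (‖0‖≤ ℝ.≤-refl))
      go {suc p} (ℕ.≤′-step N≤′p) = ‖‖≤-cong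
        (expSum-suc w p (expSum w N))
        (‖‖≤-≈ telescope (‖‖≤-+ (go N≤′p) (expTerm-weak (suc p))))
        where
        telescope : fromℕ L ℝ.* (½ ℝ.^ N ℝ.- ½ ℝ.^ p) ℝ.+ fromℕ L ℝ.* ½ ℝ.^ suc p
          ℝ.≈ fromℕ L ℝ.* (½ ℝ.^ N ℝ.- ½ ℝ.^ suc p)
        telescope = ℝ.trans
          (ℝ.+-congʳ (ℝ.*-congˡ (ℝ.+-congˡ (ℝ.-‿cong (ℝ.sym (ℝ.½^-double p))))))
          (solve 3 (λ l n h → l :* (n :- (h :+ h)) :+ l :* h := l :* (n :- h)) ℝ.refl (fromℕ L) (½ ℝ.^ N) (½ ℝ.^ suc p))

    -- Row i of the error is at most 2 · K4⁻ⁱ · L2⁻ᴺ⁺ⁱ = 2KL · 2⁻ᴺ · 2⁻ⁱ, with the 2 due to the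
    -- maximum norm; the geometric series over i doubles this once more.
    expSum-* : ∀ {z} K → (∀ j → ‖ expTerm z j ‖≤ fromℕ K ℝ.* (½ ℝ.^ j ℝ.* ½ ℝ.^ j)) → ∀ N →
      ‖ expSum z N * expSum w N - expSum (z + w) N ‖≤ fromℕ (2 ℕ.* (2 ℕ.* (K ℕ.* L))) ℝ.* ½ ℝ.^ N
    expSum-* {z} K z-term≤ N = ‖‖≤-≈ double
      (‖‖≤-cong (sym (expTo-+ 1/_! n!*1/n!≈1 z w N)) (‖∑‖≤ N {B = B} summand))
      where
      open ℝ-Solver
      open SetoidReasoning (CommutativeRing.setoid ℝ.commutativeRing)
      B = fromℕ (2 ℕ.* (K ℕ.* L)) ℝ.* ½ ℝ.^ N

      two* : ∀ n → fromℕ (2 ℕ.* n) ℝ.≈ fromℕ n ℝ.+ fromℕ n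
      two* n = ℝ.trans (ℝ.fromℕ-+ n (n ℕ.+ 0)) (ℝ.+-congˡ (ℝ.reflexive (≡.cong fromℕ (ℕ.+-identityʳ n))))

      double : B ℝ.+ B ℝ.≈ fromℕ (2 ℕ.* (2 ℕ.* (K ℕ.* L))) ℝ.* ½ ℝ.^ N
      double = ℝ.trans (ℝ.sym (ℝ.distribʳ _ _ _)) (ℝ.*-congʳ (ℝ.sym (two* (2 ℕ.* (K ℕ.* L)))))

      summand : ∀ {i} → i ℕ.≤ N →
        ‖ expTerm z i * (expSum w N - expSum w (N ℕ.∸ i)) ‖≤ B ℝ.* ½ ℝ.^ i
      summand {i} i≤N = ‖‖≤-≈ eq (‖‖≤-* (z-term≤ i) (expSum-tail (ℕ.m∸n≤m N i)))
        where
        h = ½ ℝ.^ i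
        k = fromℕ K
        l = fromℕ L
        g = ½ ℝ.^ (N ℕ.∸ i)

        gh : g ℝ.* h ℝ.≈ ½ ℝ.^ N
        gh = ℝ.trans (ℝ.sym (ℝ.^-homo-* ½ (N ℕ.∸ i) i)) (ℝ.reflexive (≡.cong (½ ℝ.^_) (ℕ.m∸n+n≡m i≤N)))

        eq : k ℝ.* (h ℝ.* h) ℝ.* (l ℝ.* g) ℝ.+ k ℝ.* (h ℝ.* h) ℝ.* (l ℝ.* g) ℝ.≈ B ℝ.* h
        eq = begin
          k ℝ.* (h ℝ.* h) ℝ.* (l ℝ.* g) ℝ.+ k ℝ.* (h ℝ.* h) ℝ.* (l ℝ.* g)
            ≈⟨ solve 4 (λ k h l g → k :* (h :* h) :* (l :* g) :+ k :* (h :* h) :* (l :* g)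
                                 := (k :* l :+ k :* l) :* (g :* h) :* h) ℝ.refl k h l g ⟩
          (k ℝ.* l ℝ.+ k ℝ.* l) ℝ.* (g ℝ.* h) ℝ.* h
            ≈⟨ ℝ.*-congʳ (ℝ.*-cong (ℝ.sym (ℝ.trans (two* (K ℕ.* L)) (ℝ.+-cong (ℝ.fromℕ-* K L) (ℝ.fromℕ-* K L)))) gh) ⟩
          B ℝ.* h ∎

  -- The place where completeness enters. It supplies e^{ix} at the point x where a zero of the sine
  -- has to be exhibited.
  isExp-exists : ∀ z → ∃[ w ] IsExp z w
  isExp-exists z =
    let L , term≤ = expTerm-bounded z
        x , re→x = ℝ.complete _ (cauchy-½^ L (λ N p N≤p → proj₁ (expSum-tail L term≤ N≤p)))
        y , im→y = ℝ.complete _ (cauchy-½^ L (λ N p N≤p → proj₂ (expSum-tail L term≤ N≤p)))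
    in (x +i y) , re→x , im→y

  expSum-*-null : ∀ z w → let d = λ N → expSum z N * expSum w N - expSum (z + w) N in
    Null (λ N → re (d N)) × Null (λ N → im (d N))
  expSum-*-null z w =
    let K , z-term≤ = expTerm-bounded z
        L , w-term≤ = expTerm-bounded w
        C = 2 ℕ.* (2 ℕ.* (K ℕ.* L))
        small = expSum-* L w-term≤ K z-term≤
    in null-½^ C (λ N → proj₁ (small N)) , null-½^ C (λ N → proj₂ (small N))

  isExp-+ : ∀ {z z′ w w′} → IsExp z w → IsExp z′ w′ → IsExp (z + z′) (w * w′)
  isExp-+ {z} {z′} (re→ , im→) (re→′ , im→′) =
      correction (convergesTo-+ (convergesTo-* re→ re→′) (convergesTo-neg (convergesTo-* im→ im→′))) re-null
    , correction (convergesTo-+ (convergesTo-* re→ im→′) (convergesTo-* im→ re→′)) im-null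
    where
    open ℝ-Solver
    re-null = proj₁ (expSum-*-null z z′)
    im-null = proj₂ (expSum-*-null z z′)

    correction : ∀ {a b x} → ℝ.ConvergesTo a x → Null (λ N → a N ℝ.- b N) → ℝ.ConvergesTo b x
    correction {a} {b} {x} a→x a-b-null = null⇒converges (null-cong
      (λ N → solve 3 (λ a b x → (a :- x) :- (a :- b) := b :- x) ℝ.refl (a N) (b N) x)
      (null-+ (converges⇒null a→x) (null-neg a-b-null)))

  isExp-unique : ∀ {z w w′} → IsExp z w → IsExp z w′ → w ≈ w′
  isExp-unique (re→ , im→) (re→′ , im→′) = convergesTo-unique re→ re→′ , convergesTo-unique im→ im→′

  isExp-via : ∀ {z w} {g : ℕ → ℂ} → (∀ N → g N ≈ expSum z N) →
    ℝ.ConvergesTo (λ N → re (g N)) (re w) → ℝ.ConvergesTo (λ N → im (g N)) (im w) → IsExp z w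
  isExp-via g≈ re→ im→ =
    convergesTo-cong (λ N → proj₁ (g≈ N)) ℝ.refl re→ , convergesTo-cong (λ N → proj₂ (g≈ N)) ℝ.refl im→

  isExp-congˡ : ∀ {z z′ w} → z ≈ z′ → IsExp z w → IsExp z′ w
  isExp-congˡ {z} {z′} z≈z′ (re→ , im→) = isExp-via {g = expSum z}
    (λ N → ∑-cong-≤ N (λ {j} _ → *-congˡ {1/ j !} (^-congˡ j z≈z′))) re→ im→
    where open SemiringExp semiring using (^-congˡ)

  isExp-congʳ : ∀ {z w w′} → w ≈ w′ → IsExp z w → IsExp z w′
  isExp-congʳ (p , q) (re→ , im→) =
    convergesTo-cong (λ _ → ℝ.refl) p re→ , convergesTo-cong (λ _ → ℝ.refl) q im→

  isExp-0 : IsExp 0# 1#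
  isExp-0 = isExp-via {g = λ _ → 1#} (λ N → sym (expSum-0 N)) (convergesTo-const ℝ.1#) (convergesTo-const ℝ.0#)
    where
    open ℂ-Solver
    open SetoidReasoning setoid
    positive-terms : ∀ {j} → 0 ℕ.< j → expTerm 0# j ≈ 0#
    positive-terms {suc j} _ = trans (*-congˡ {1/ suc j !} (zeroˡ (0# ^ j))) (zeroʳ (1/ suc j !))

    expSum-0 : ∀ N → expSum 0# N ≈ 1#
    expSum-0 N = begin
      expSum 0# N         ≈⟨ ∑-extend {0} {N} (expTerm 0#) ℕ.z≤n positive-terms ⟨
      1/ 0 ! * 1# + 0#    ≈⟨ solve 1 (λ r → r :* con (+ 1) :+ con (+ 0) := (con (+ 1) :+ con (+ 0)) :* r)
                               refl (1/ 0 !) ⟩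
      (0 !) ⋆ 1# * 1/ 0 ! ≈⟨ n!*1/n!≈1 0 ⟩
      1#                  ∎

  isExp-⋆ : ∀ {z w} n → IsExp z w → IsExp (n ⋆ z) (w ^ n)
  isExp-⋆ zero    z→w = isExp-0
  isExp-⋆ (suc n) z→w = isExp-+ z→w (isExp-⋆ n z→w)

  conj : ℂ → ℂ
  conj z = re z +i (ℝ.- im z)

  conj-* : ∀ z w → conj z * conj w ≈ conj (z * w)
  conj-* (a +i b) (x +i y) =
    solve 4 (λ a b x y → a :* x :- (:- b) :* (:- y) := a :* x :- b :* y) ℝ.refl a b x y ,
    solve 4 (λ a b x y → a :* (:- y) :+ (:- b) :* x := :- (a :* y :+ b :* x)) ℝ.refl a b x y
    where open ℝ-Solver

  conj-^ : ∀ z n → conj z ^ n ≈ conj (z ^ n)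
  conj-^ z zero    = ℝ.refl , solve 0 (con (+ 0) := :- con (+ 0)) ℝ.refl
    where open ℝ-Solver
  conj-^ z (suc n) = trans (*-congˡ {conj z} (conj-^ z n)) (conj-* z (z ^ n))

  conj-∑ : ∀ t F → ∑[0⋯ t ] (λ j → conj (F j)) ≈ conj (∑[0⋯ t ] F)
  conj-∑ zero F = ℝ.refl , solve 1 (λ y → :- y :+ con (+ 0) := :- (y :+ con (+ 0))) ℝ.refl (im (F 0))
    where open ℝ-Solver
  conj-∑ (suc t) F = trans (+-congˡ {conj (F 0)} (conj-∑ t (λ j → F (suc j))))
    ( ℝ.refl
    , solve 2 (λ y y′ → :- y :+ :- y′ := :- (y :+ y′)) ℝ.refl
        (im (F 0)) (im (∑[0⋯ t ] (λ j → F (suc j)))))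
    where open ℝ-Solver

  -- The coefficients 1/j! are real, so conjugation passes through every partial sum.
  isExp-conj : ∀ {z w} → IsExp z w → IsExp (conj z) (conj w)
  isExp-conj {z} (re→ , im→) =
    isExp-via {g = λ N → conj (expSum z N)} (λ N → sym (expSum-conj N)) re→ (convergesTo-neg im→)
    where
    open ℝ-Solver
    conj-cong : ∀ {z w} → z ≈ w → conj z ≈ conj w
    conj-cong (p , q) = p , ℝ.-‿cong q

    ofReal-conj : ∀ x z → ofReal x * conj z ≈ conj (ofReal x * z)
    ofReal-conj x z = trans (ofReal-* x (conj z)) (trans
      (ℝ.refl , solve 2 (λ x y → x :* (:- y) := :- (x :* y)) ℝ.refl x (im z))
      (conj-cong (sym (ofReal-* x z))))

    expTerm-conj : ∀ j → expTerm (conj z) j ≈ conj (expTerm z j)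
    expTerm-conj j = trans (*-congˡ {1/ j !} (conj-^ z j)) (ofReal-conj (re (1/ j !)) (z ^ j))

    expSum-conj : ∀ N → expSum (conj z) N ≈ conj (expSum z N)
    expSum-conj N = trans (∑-cong-≤ N (λ {j} _ → expTerm-conj j)) (conj-∑ N (expTerm z))

-- e^{2πi/n} is a regular root of unity.

module PrimitiveRoot {c ℓ₁ ℓ₂ ℓ₃} (ℝ : RealNumbers c ℓ₁ ℓ₂ ℓ₃) where
  private
    module ℝ where
      open RealNumbers ℝ public
      open OrderedFieldProperties orderedField public
  open ℝ using (fromℕ; recip)
  open ComplexNumbers ℝ
  open ComplexRing ℝ
  open ComplexExponential ℝ
  open CommutativeRing ℂ-commutativeRing using (semiring; refl; sym; trans)
  open RootsOfUnity ℂ-commutativeRing using (IsRegularRoot)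
  open SemiringMult semiring using () renaming (_×_ to _⋆_)
  open ℝ-Solver

  i[_] : ℝ.Carrier → ℂ
  i[ x ] = ℝ.0# +i x

  ⋆-i[] : ∀ n x → n ⋆ i[ x ] ≈ i[ fromℕ n ℝ.* x ]
  ⋆-i[] zero    x = ℝ.refl , ℝ.sym (ℝ.zeroˡ x)
  ⋆-i[] (suc n) x =
    ℝ.trans (ℝ.+-congˡ (proj₁ (⋆-i[] n x))) (ℝ.+-identityʳ ℝ.0#) ,
    ℝ.trans (ℝ.+-congˡ (proj₂ (⋆-i[] n x)))
      (solve 2 (λ x n → x :+ n :* x := (con (+ 1) :+ n) :* x) ℝ.refl x (fromℕ n))

  isExp-i[]-cong : ∀ {x y w} → x ℝ.≈ y → IsExp i[ x ] w → IsExp i[ y ] w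
  isExp-i[]-cong x≈y = isExp-congˡ (ℝ.refl , x≈y)

  isExp-i[]-⋆ : ∀ {x w} n → IsExp i[ x ] w → IsExp i[ fromℕ n ℝ.* x ] (w ^ n)
  isExp-i[]-⋆ {x} n e = isExp-congˡ (⋆-i[] n x) (isExp-⋆ n e)

  -- The conjugate of ix is its negative, so the product is e⁰.
  isExp-i[]-conj : ∀ {x w} → IsExp i[ x ] w → w * conj w ≈ 1#
  isExp-i[]-conj {x} e = isExp-unique
    (isExp-congˡ (solve 0 (con (+ 0) :+ con (+ 0) := con (+ 0)) ℝ.refl , ℝ.-‿inverseʳ x)
      (isExp-+ e (isExp-conj e)))
    isExp-0

  fromℕ2 : ∀ x → x ℝ.+ x ℝ.≈ fromℕ 2 ℝ.* x
  fromℕ2 = solve 1 (λ x → x :+ x := (con (+ 1) :+ (con (+ 1) :+ con (+ 0))) :* x) ℝ.refl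

  isExp-i[]-square : ∀ {x w} → IsExp i[ x ] w → IsExp i[ fromℕ 2 ℝ.* x ] (w * w)
  isExp-i[]-square {x} e = isExp-congˡ (ℝ.+-identityʳ ℝ.0# , fromℕ2 x) (isExp-+ e e)

  -- sin π = 0 makes e^{iπ} a real number t, which is its own conjugate; so t² is e^{iπ} times its
  -- conjugate.
  isExp-2πi : ∀ {π} → IsPi π → IsExp i[ fromℕ 2 ℝ.* π ] 1#
  isExp-2πi {π} (_ , (t , e) , _) = isExp-congʳ (trans real (isExp-i[]-conj e)) (isExp-i[]-square e)
    where
    real : (t +i ℝ.0#) * (t +i ℝ.0#) ≈ (t +i ℝ.0#) * conj (t +i ℝ.0#)
    real = solve 1 (λ t → t :* t :- con (+ 0) :* con (+ 0) := t :* t :- con (+ 0) :* (:- con (+ 0))) ℝ.refl t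
         , solve 1 (λ t → t :* con (+ 0) :+ con (+ 0) :* t := t :* (:- con (+ 0)) :+ con (+ 0) :* t) ℝ.refl t

  -- w² = 1 and w w̄ = 1 give 2 (im w)² = 0.
  isExp-2ix≈1⇒sin≈0 : ∀ {x} → IsExp i[ fromℕ 2 ℝ.* x ] 1# → IsSin x ℝ.0#
  isExp-2ix≈1⇒sin≈0 {x} e₂ = from (proj₁ (isExp-exists i[ x ])) (proj₂ (isExp-exists i[ x ]))
    where
    s²+s²≈0 : ∀ t s → t ℝ.* t ℝ.- s ℝ.* s ℝ.≈ ℝ.1# → t ℝ.* t ℝ.- s ℝ.* (ℝ.- s) ℝ.≈ ℝ.1# →
      s ℝ.* s ℝ.+ s ℝ.* s ℝ.≈ ℝ.0#
    s²+s²≈0 t s p q = ℝ.trans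
      (solve 2 (λ t s → s :* s :+ s :* s := (t :* t :- s :* (:- s)) :- (t :* t :- s :* s)) ℝ.refl t s)
      (ℝ.trans (ℝ.+-cong q (ℝ.-‿cong p)) (ℝ.-‿inverseʳ ℝ.1#))

    from : ∀ w → IsExp i[ x ] w → IsSin x ℝ.0#
    from (t +i s) e = t , isExp-congʳ (ℝ.refl , ℝ.xx+yy≈0⇒x≈0 {s} {s} (s²+s²≈0 t s
      (proj₁ (isExp-unique (isExp-i[]-square e) e₂)) (proj₁ (isExp-i[]-conj e)))) e

  ζ^n≈1 : ∀ n .{{_ : ℕ.NonZero n}} {ζ} → Isζ n ζ → ζ ^ n ≈ 1#
  ζ^n≈1 n (π , isPi , e) = isExp-unique (isExp-i[]-cong cancel (isExp-i[]-⋆ n e)) (isExp-2πi isPi)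
    where
    cancel : fromℕ n ℝ.* (fromℕ 2 ℝ.* π ℝ.* recip n) ℝ.≈ fromℕ 2 ℝ.* π
    cancel = ℝ.trans (solve 3 (λ n p r → n :* (p :* r) := p :* (n :* r)) ℝ.refl (fromℕ n) (fromℕ 2 ℝ.* π) (recip n))
      (ℝ.trans (ℝ.*-congˡ (ℝ.fromℕ-recip n)) (ℝ.*-identityʳ _))

  ζ^r≉1 : ∀ n .{{_ : ℕ.NonZero n}} {ζ} → Isζ n ζ → ∀ {r} → 0 ℕ.< r → r ℕ.< n → ¬ (ζ ^ r ≈ 1#)
  ζ^r≉1 n {ζ} (π , (0<π , _ , least) , e) {suc r} _ r<n ζ^r≈1 =
    least x 0<x x<π (isExp-2ix≈1⇒sin≈0 (isExp-i[]-cong arrange (isExp-congʳ ζ^r≈1 (isExp-i[]-⋆ (suc r) e))))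
    where
    u v x : ℝ.Carrier
    u = fromℕ (suc r)
    v = fromℕ (n ℕ.∸ suc r)
    x = u ℝ.* (π ℝ.* recip n)

    arrange : u ℝ.* (fromℕ 2 ℝ.* π ℝ.* recip n) ℝ.≈ fromℕ 2 ℝ.* x
    arrange = solve 4 (λ u t p r → u :* (t :* p :* r) := t :* (u :* (p :* r))) ℝ.refl u (fromℕ 2) π (recip n)

    0<π/n : ℝ.0# ℝ.< π ℝ.* recip n
    0<π/n = ℝ.*-pos 0<π (ℝ.recip-pos n)

    0<x : ℝ.0# ℝ.< x
    0<x = ℝ.*-pos (ℝ.0<fromℕ r) 0<π/n

    fromℕ-pos : ∀ {m} → 0 ℕ.< m → ℝ.0# ℝ.< fromℕ m
    fromℕ-pos {suc m} _ = ℝ.0<fromℕ m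

    -- π - x is (n - r - 1)π/n for the bound variable r of this clause, a positive multiple of π/n,
    -- so x < π.
    π-x : v ℝ.* (π ℝ.* recip n) ℝ.≈ π ℝ.- x
    π-x = ℝ.trans
      (solve 4 (λ u v p r → v :* (p :* r) := p :* ((u :+ v) :* r) :- u :* (p :* r)) ℝ.refl u v π (recip n))
      (ℝ.+-congʳ (ℝ.trans (ℝ.*-congˡ (ℝ.trans (ℝ.*-congʳ u+v≈n) (ℝ.fromℕ-recip n))) (ℝ.*-identityʳ π)))
      where
      u+v≈n : u ℝ.+ v ℝ.≈ fromℕ n
      u+v≈n = ℝ.trans (ℝ.sym (ℝ.fromℕ-+ (suc r) (n ℕ.∸ suc r)))
        (ℝ.reflexive (≡.cong fromℕ (ℕ.m+[n∸m]≡n (ℕ.<⇒≤ r<n))))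

    x<π : x ℝ.< π
    x<π = ℝ.0<y-x⇒x<y (ℝ.<-respʳ-≈ π-x (ℝ.*-pos (fromℕ-pos (ℕ.m<n⇒0<n∸m r<n)) 0<π/n))

  -- With u = w - 1, the equation u a = 0 gives |u|² a = 0.
  wa≈a⇒a≈0 : ∀ {w a} → ¬ (w ≈ 1#) → w * a ≈ a → a ≈ 0#
  wa≈a⇒a≈0 {p +i q} {x +i y} w≉1 (re≈ , im≈) = ℝ.xy≈0⇒y≈0 N≉0 Nx≈0 , ℝ.xy≈0⇒y≈0 N≉0 Ny≈0
    where
    u N : ℝ.Carrier
    u = p ℝ.- ℝ.1#
    N = u ℝ.* u ℝ.+ q ℝ.* q

    N≉0 : ¬ (N ℝ.≈ ℝ.0#)
    N≉0 N≈0 = w≉1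
      ( ℝ.trans (solve 1 (λ p → p := (p :- con (+ 1)) :+ con (+ 1)) ℝ.refl p)
          (ℝ.trans (ℝ.+-congʳ (ℝ.xx+yy≈0⇒x≈0 N≈0)) (ℝ.+-identityˡ ℝ.1#))
      , ℝ.xx+yy≈0⇒x≈0 (ℝ.trans (ℝ.+-comm (q ℝ.* q) (u ℝ.* u)) N≈0))

    A B : ℝ.Carrier
    A = (p ℝ.* x ℝ.- q ℝ.* y) ℝ.- x
    B = (p ℝ.* y ℝ.+ q ℝ.* x) ℝ.- y

    A≈0 : A ℝ.≈ ℝ.0#
    A≈0 = ℝ.trans (ℝ.+-congʳ re≈) (ℝ.-‿inverseʳ x)

    B≈0 : B ℝ.≈ ℝ.0#
    B≈0 = ℝ.trans (ℝ.+-congʳ im≈) (ℝ.-‿inverseʳ y)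

    -- A + iB is (w - 1)a. Multiplying by the conjugate of w - 1 takes (s, t) = (u, q) for the real
    -- part and (-q, u) for the imaginary part.
    combination : ∀ s t → s ℝ.* A ℝ.+ t ℝ.* B ℝ.≈ ℝ.0#
    combination s t = ℝ.trans (ℝ.+-cong (ℝ.*-congˡ A≈0) (ℝ.*-congˡ B≈0))
      (solve 2 (λ s t → s :* con (+ 0) :+ t :* con (+ 0) := con (+ 0)) ℝ.refl s t)

    Nx≈0 : N ℝ.* x ℝ.≈ ℝ.0#
    Nx≈0 = ℝ.trans
      (solve 4 (λ p q x y → ((p :- con (+ 1)) :* (p :- con (+ 1)) :+ q :* q) :* x
        := (p :- con (+ 1)) :* ((p :* x :- q :* y) :- x) :+ q :* ((p :* y :+ q :* x) :- y)) ℝ.refl p q x y)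
      (combination u q)

    Ny≈0 : N ℝ.* y ℝ.≈ ℝ.0#
    Ny≈0 = ℝ.trans
      (solve 4 (λ p q x y → ((p :- con (+ 1)) :* (p :- con (+ 1)) :+ q :* q) :* y
        := (:- q) :* ((p :* x :- q :* y) :- x) :+ (p :- con (+ 1)) :* ((p :* y :+ q :* x) :- y)) ℝ.refl p q x y)
      (combination (ℝ.- q) u)

  isRegularRoot : ∀ n {ζ} → Isζ (suc n) ζ → IsRegularRoot n ζ
  isRegularRoot n isζ = record
    { ζⁿ≈1      = ζ^n≈1 (suc n) isζ
    ; ζʳa≈a⇒a≈0 = λ 0<r r≤n → wa≈a⇒a≈0 (ζ^r≉1 (suc n) isζ 0<r (ℕ.s≤s r≤n))
    }

open import Data.Nat.Base using (NonZero; _≤_; _>_; _∸_; _⊓_; _/_) renaming (_*_ to _·_)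

corollary1p7 : ∀ {c ℓ₁ ℓ₂ ℓ₃} (ℝ : RealNumbers c ℓ₁ ℓ₂ ℓ₃) → let open ComplexNumbers ℝ in
    (k n : ℕ) → .{{_ : NonZero k}} → .{{_ : NonZero n}} → 2 ≤ n →
    (ζ : ℂ) → Isζ n ζ →
    (m : ℕ) (ξ : Vector ℂ k) →
    (ℋ m (ξ ⊗ powers n ζ)
    ≈ (∑[0⋯ m / n ] λ j → (- 1#) ^ (m ∸ j · n) * ℰ (m ∸ j · n) ξ * ℋ j (ξ ^ᵛ n)))
    × (m ≤ (n ∸ 1) · k →
    ℰ m (ξ ⊗ powers n ζ)
    ≈ (∑[0⋯ m / n ] λ j → (- 1#) ^ (m ∸ j) * ℋ (m ∸ j · n) ξ * ℰ j (ξ ^ᵛ n)))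
    × (m > (n ∸ 1) · k →
    (∑[0⋯ (m ⊓ (n · k)) / n ] λ j → (- 1#) ^ (m ∸ j) * ℋ (m ∸ j · n) ξ * ℰ j (ξ ^ᵛ n))
    ≈ 0#)
-- For n = `suc n′` both `n ∸ 1` and `powers n ζ` compute, to `n′` and to the vector `ζ⃗ root`, so
-- the identities over a general ring apply as they stand.
corollary1p7 ℝ k (suc n′) 2≤n ζ isζ m ξ = ℋ-⊗ root ξ m , (λ _ → ℰ-⊗ root ξ m) , ℰ-⊗-vanishing root ξ m
  where
  open ComplexRing ℝ using (ℂ-commutativeRing)
  open RootsOfUnityIdentities ℂ-commutativeRing using (ℋ-⊗; ℰ-⊗; ℰ-⊗-vanishing)
  root = PrimitiveRoot.isRegularRoot ℝ n′ isζ
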